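{- Let $p>155$ be a prime and let $G$ be a cyclic group of order $p$. Let $T$ be a minimal zero-sum sequence over $G$ of length $|T|\ge \frac{p-1}{2}$. Then $\operatorname{ind}(T)\le 2$.
   Context: A sequence over an abelian group $G$ is a finite unordered list of elements of $G$ with repetition allowed; $|T|$ is its length, $\operatorname{supp}(T)$ the set of elements occurring in it, and $\sigma(T)$ the sum of its terms. $T$ is a minimal zero-sum sequence if $\sigma(T)=0$ and no subsequence $U$ with $1\le|U|<|T|$ has $\sigma(U)=0$. For $g\in G$ nonzero of order $n$ and $T=(x_1g)\cdots(x_lg)$ with integers $1\le x_i\le n$, the $g$-norm is $\|T\|_g=(x_1+\dots+x_l)/n$. If $\langle\operatorname{supp}(T)\rangle$ is a nontrivial finite cyclic group, the index is $\operatorname{ind}(T)=\min\{\|T\|_g: g\in G,\ \langle\operatorname{supp}(T)\rangle=\langle g\rangle\}$. -}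

module Defs where

open import Algebra.Bundles using (AbelianGroup)
open import Data.Fin.Base using (Fin)
open import Data.Integer.Base using (+_)
open import Data.List.Base as List using (List; foldr; length; _++_)
open import Data.List.Relation.Binary.Pointwise using (Pointwise)
open import Data.Nat.Base using (ℕ; NonZero; _≤_; _<_)
open import Data.Product.Base using (∃-syntax; _×_; _,_)
open import Data.Rational.Base as ℚ using (ℚ)
import Data.Rational.Properties as ℚ
open import Function.Bundles using (Inverse)
open import Level using (Level; _⊔_)
open import Relation.Binary.PropositionalEquality using (_≡_; setoid)
open import Relation.Nullary.Negation using (¬_)
open import Relation.Unary using (Pred; _∈_; _≐_)

import Algebra.Properties.Monoid.Mult as Mult
import Data.List.Membership.Setoid as Membership
import Data.List.Relation.Binary.Permutation.Setoid as Permutation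

module _ {c ℓ : Level} (G : AbelianGroup c ℓ) where

  open AbelianGroup G using (Carrier; _≈_; _∙_; ε; _⁻¹; monoid)
    renaming (setoid to setoidG)
  open Mult monoid using () renaming (_×_ to _·_)

  data ⟨_⟩ {s : Level} (S : Pred Carrier s) : Pred Carrier (c ⊔ ℓ ⊔ s) where
    gen  : ∀ {x} → x ∈ S → ⟨_⟩ S x
    unit : ⟨_⟩ S ε
    mul  : ∀ {x y} → ⟨_⟩ S x → ⟨_⟩ S y → ⟨_⟩ S (x ∙ y)
    inv  : ∀ {x} → ⟨_⟩ S x → ⟨_⟩ S (x ⁻¹)
    resp : ∀ {x y} → x ≈ y → ⟨_⟩ S x → ⟨_⟩ S y

  ⟨_⟩₁ : Carrier → Pred Carrier (c ⊔ ℓ)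
  ⟨ g ⟩₁ = ⟨_⟩ (_≈ g)

  IsCyclic : Set (c ⊔ ℓ)
  IsCyclic = ∃[ g ] (∀ x → x ∈ ⟨ g ⟩₁)

  -- The elements of G, counted up to its equality _≈_, are n in number.
  HasCardinality : ℕ → Set (c ⊔ ℓ)
  HasCardinality n = Inverse (setoid (Fin n)) setoidG

  record HasOrder (g : Carrier) (n : ℕ) : Set ℓ where
    field
      {{nonZero}} : NonZero n
      annihilates : n · g ≈ ε
      least       : ∀ m → 1 ≤ m → m < n → ¬ (m · g ≈ ε)

  -- Sequences over G are unordered; they are represented by lists, and all the
  -- notions below are invariant under permutation (and under _≈_ termwise).
  Sequence : Set c
  Sequence = List Carrier

  σ : Sequence → Carrier
  σ = foldr _∙_ ε

  supp : Sequence → Pred Carrier (c ⊔ ℓ)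
  supp T x = Membership._∈_ setoidG x T

  -- As multisets: T is the union of U and some V.
  _IsSubsequenceOf_ : Sequence → Sequence → Set (c ⊔ ℓ)
  U IsSubsequenceOf T = ∃[ V ] Permutation._↭_ setoidG (U ++ V) T

  record IsMinimalZeroSum (T : Sequence) : Set (c ⊔ ℓ) where
    field
      zeroSum : σ T ≈ ε
      minimal : ∀ U → U IsSubsequenceOf T → 1 ≤ length U → length U < length T →
                ¬ (σ U ≈ ε)

  -- HasNorm g T q means ‖T‖_g = q.  The coefficients are determined by g and T,
  -- since the multiples 1·g, …, n·g are pairwise distinct.
  record HasNorm (g : Carrier) (T : Sequence) (q : ℚ) : Set (c ⊔ ℓ) where
    field
      nonzero      : ¬ (g ≈ ε)
      n            : ℕ
      order        : HasOrder g n
      coefficients : List ℕ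
      represents   : Pointwise (λ x t → (1 ≤ x × x ≤ n) × t ≈ x · g) coefficients T
      norm         : q ≡ ℚ._/_ (+ List.sum coefficients) n {{HasOrder.nonZero order}}

  -- HasIndex T q means ind(T) = q.  No q qualifies unless ⟨supp T⟩ is a
  -- nontrivial finite cyclic group.
  record HasIndex (T : Sequence) (q : ℚ) : Set (c ⊔ ℓ) where
    field
      attained   : ∃[ g ] (⟨_⟩ (supp T) ≐ ⟨ g ⟩₁) × HasNorm g T q
      lowerBound : ∀ g r → ⟨_⟩ (supp T) ≐ ⟨ g ⟩₁ → HasNorm g T r → q ℚ.≤ r

  hasIndex-unique : ∀ {T q r} → HasIndex T q → HasIndex T r → q ≡ r
  hasIndex-unique i j = ℚ.≤-antisym (below i j) (below j i)
    where
    below : ∀ {T q r} → HasIndex T q → HasIndex T r → q ℚ.≤ r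
    below i j with HasIndex.attained j
    ... | g , generates , norm = HasIndex.lowerBound i g _ generates norm

{-# OPTIONS --safe #-}
module Submission where

-- Fix a cyclic group of order p, write a sequence as residues mod p, and measure a
-- subsequence U by the number of its subset sums (counting 0).  If that number is at
-- least 2|U| + 4, keep adding terms that contribute two or more new sums.  As
-- |T| ≥ (p − 1)/2 this must stop early, and then all remaining terms contribute one
-- sum only, so the sumset is a progression and these terms are all equal.  Hence no
-- proper U has more than 2|U| + α + 2 sums, where α is the largest multiplicity in T.
-- Counting pairs of sums by their difference gives α ≥ 8.
--
-- Scale so that 1 has multiplicity α, and let V be a largest part of T, containing the
-- ones, whose sums fill an interval [0, s] without wrapping around.  If any two of the
-- other terms have sum at most s + 1 mod p, pairing them shows that doubling T gives
-- norm at most 2.  Otherwise two of them produce three disjoint intervals of sums; the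
-- bound above then forces V = 1^α and a second term k of multiplicity at least α − 3
-- with 2k ∈ {1, 3} or 3k ∈ {1, 2} mod p.  In a unit where T contains 1s and 2s or 1s and 3s
-- the same alternative leaves no room for intervals; where it consists of 2s and 3s and
-- larger terms, their sums fill [0, s] up to two gaps and the norm is again at most 2.

import Algebra.Properties.Group as GroupProperties
import Algebra.Properties.Monoid.Mult as Mult
open import Algebra.Bundles using (AbelianGroup)
open import Data.Bool.Base using (Bool; true; false; _∨_; _∧_; not)
open import Data.Bool.Properties using (∨-zeroʳ)
open import Data.Empty using (⊥; ⊥-elim)
open import Data.Fin.Base as Fin using (Fin)
import Data.Fin.Properties as Fin
import Data.Integer.Base as ℤ
import Data.Integer.Properties as ℤ
open import Data.List.Base using (List; []; _∷_; _++_; map; length; replicate; applyUpTo)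
open import Data.List.Base using () renaming ([] to ∅; _∷_ to _◂_)
open import Data.List.Membership.Propositional using (_∈_; find)
open import Data.List.Membership.Propositional.Properties using (∈-++⁺ˡ; ∈-++⁻; ∈-∃++; ∈-applyUpTo⁻)
open import Data.List.Properties using (length-++; length-map; map-++; length-replicate; ++-assoc; ∷-injective; map-replicate; length-applyUpTo; map-applyUpTo)
open import Data.List.Relation.Binary.Permutation.Propositional using (_↭_; refl; prep; swap; trans; ↭-sym; ↭-refl; ↭-trans; ↭-reflexive)
import Data.List.Relation.Binary.Permutation.Propositional.Properties as ↭
import Data.List.Relation.Binary.Permutation.Setoid as SetoidPermutation
open import Data.List.Relation.Binary.Pointwise using (Pointwise; []; _∷_)
open import Data.List.Relation.Unary.All as All using (All; []; _∷_)
import Data.List.Relation.Unary.All.Properties as All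
open import Data.List.Relation.Unary.AllPairs using (AllPairs; []; _∷_)
open import Data.List.Relation.Unary.Any as Any using (Any; here; there; any?)
open import Data.List.Relation.Unary.Unique.Propositional using (Unique)
import Data.List.Relation.Unary.Unique.Propositional.Properties as Unique
open import Data.Nat.Base hiding (equal; less; greater)
open import Data.Nat.Coprimality using (coprime-Bézout; prime⇒coprime)
open import Data.Nat.Divisibility using (_∣_; divides; ∣⇒≤)
open import Data.Nat.DivMod
open import Data.Nat.GCD using (module Bézout)
open import Data.Nat.ListAction using (sum)
open import Data.Nat.ListAction.Properties using (sum-++; sum-↭)
open import Data.Nat.Primality using (Prime; prime⇒irreducible; prime⇒nonZero)
open import Data.Nat.Properties
open import Data.Nat.Tactic.RingSolver using (solve-∀)
open import Data.Product.Base using (∃; ∃₂; ∃-syntax; _×_; _,_; proj₁; proj₂)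
import Data.Rational.Base as ℚ
import Data.Rational.Properties as ℚ
import Data.Rational.Unnormalised.Base as ℚᵘ
import Data.Rational.Unnormalised.Properties as ℚᵘ
open import Data.Sum.Base using (_⊎_; inj₁; inj₂)
open import Function.Base using (_∘_)
open import Function.Bundles using (Inverse)
open import Relation.Binary.Definitions using (tri<; tri≈; tri>)
open import Relation.Binary.PropositionalEquality using (_≡_; _≢_; refl; sym; ≢-sym; cong; cong₂; subst; subst₂; module ≡-Reasoning)
open import Relation.Nullary using (¬_; Dec; yes; no; contradiction)
open import Relation.Nullary.Decidable using (from-yes; _→-dec_; _×-dec_; ¬?; decidable-stable)

open import Algebra.Solver.CommutativeMonoid (↭.++-commutativeMonoid {A = ℕ}) using () renaming (solve to rearrange; _⊜_ to _≐_; _⊕_ to _∪_)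

-- The bound 2|U| + α + 2 acts as a budget: j disjoint translates of an interval [0, M] of sums need
-- j(M + 1) ≤ 2|U| + α + 2. For U consisting of 1^α and two more terms the budget is 3α + 6, and
-- three translates of [0, α] cost 3α + 3, so three are just affordable. This near break-even is the
-- obstacle that shapes the proof. A further term in V, being at least 2, makes three translates too
-- expensive; a fourth translate does the same; and the slack of 3 is the origin of the α - 3 equal
-- terms k. With 2k or 3k congruent to a small w, blocks of two or three k's prolong the interval by
-- w each, and the budget leaves only tiny w. Those with k ≡ 0, 1 or 2 are impossible, which leaves
-- the four listed congruences. Multiplying by 2 or 3 then replaces 1 and k by 2 and 3, or turns the
-- k's into units beside twos or threes. The bound α ≥ 8 supplies the five copies of k that these
-- counts use.

infixr 5 _⨟_

_⨟_ : ∀ {a} {A : Set a} {x y z : A} → x ≡ y → y ≡ z → x ≡ z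
refl ⨟ eq = eq

infixl 6 _⊕_
infixl 7 _⊗_

_⊕_ : ∀ {a b c d} → a ≤ b → c ≤ d → a + c ≤ b + d
_⊕_ = +-mono-≤

_⊗_ : ∀ k {a b} → a ≤ b → k * a ≤ k * b
k ⊗ h = *-monoʳ-≤ k h

-- Linear arithmetic by certificates: X ≤ Y is a combination of the hypotheses
-- and r is the slack left over.
linear : ∀ {X Y a b} r → X ≤ Y → a + Y + r ≡ b + X → a ≤ b
linear {X} {Y} {a} {b} r h eq = +-cancelʳ-≤ Y a b (begin
  a + Y      ≤⟨ m≤m+n (a + Y) r ⟩
  a + Y + r  ≡⟨ eq ⟩
  b + X      ≤⟨ +-monoʳ-≤ b h ⟩
  b + Y      ∎)
  where open ≤-Reasoning

absurd : ∀ {A : Set} {X Y} r → X ≤ Y → X ≡ suc (Y + r) → A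
absurd {X = X} {Y} r h eq = ⊥-elim (<⇒≱ (s≤s (m≤m+n Y r)) (subst (_≤ Y) eq h))

≡⇒≤ : ∀ {a b} → a ≡ b → a ≤ b
≡⇒≤ refl = ≤-refl

≡⇒≥ : ∀ {a b} → a ≡ b → b ≤ a
≡⇒≥ refl = ≤-refl

-- Finite sums and counting with multiplicity

∑ : ℕ → (ℕ → ℕ) → ℕ
∑ zero    F = 0
∑ (suc n) F = ∑ n F + F n

∑-cong : ∀ n {F G} → (∀ i → F i ≡ G i) → ∑ n F ≡ ∑ n G
∑-cong zero    eq = refl
∑-cong (suc n) eq = cong₂ _+_ (∑-cong n eq) (eq n)

∑-mono : ∀ n {F G} → (∀ i → F i ≤ G i) → ∑ n F ≤ ∑ n G
∑-mono zero    h = z≤n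
∑-mono (suc n) h = +-mono-≤ (∑-mono n h) (h n)

private
  interchange : ∀ a b c d → (a + b) + (c + d) ≡ (a + c) + (b + d)
  interchange = solve-∀

∑-+ : ∀ n F G → ∑ n (λ i → F i + G i) ≡ ∑ n F + ∑ n G
∑-+ zero    F G = refl
∑-+ (suc n) F G rewrite ∑-+ n F G = interchange (∑ n F) (∑ n G) (F n) (G n)

∑-*ˡ : ∀ n c F → ∑ n (λ i → c * F i) ≡ c * ∑ n F
∑-*ˡ zero    c F = sym (*-zeroʳ c)
∑-*ˡ (suc n) c F rewrite ∑-*ˡ n c F = sym (*-distribˡ-+ c (∑ n F) (F n))

∑-*ʳ : ∀ n c F → ∑ n (λ i → F i * c) ≡ ∑ n F * c
∑-*ʳ zero    c F = refl
∑-*ʳ (suc n) c F rewrite ∑-*ʳ n c F = sym (*-distribʳ-+ c (∑ n F) (F n))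

∑-vanish : ∀ n {F} → (∀ i → i < n → F i ≡ 0) → ∑ n F ≡ 0
∑-vanish zero    h = refl
∑-vanish (suc n) h = cong₂ _+_ (∑-vanish n (λ i i<n → h i (m<n⇒m<1+n i<n))) (h n (n<1+n n))

∑-one : ∀ n → ∑ n (λ _ → 1) ≡ n
∑-one zero    = refl
∑-one (suc n) rewrite ∑-one n = +-comm n 1

∑-swap : ∀ m n (F : ℕ → ℕ → ℕ) → ∑ m (λ i → ∑ n (F i)) ≡ ∑ n (λ j → ∑ m (λ i → F i j))
∑-swap zero    n F = sym (∑-vanish n (λ _ _ → refl))
∑-swap (suc m) n F rewrite ∑-swap m n F = sym (∑-+ n (λ j → ∑ m (λ i → F i j)) (F m))

∑-head : ∀ n F → ∑ (suc n) F ≡ F 0 + ∑ n (F ∘ suc)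
∑-head zero    F = +-comm 0 (F 0)
∑-head (suc n) F rewrite ∑-head n F = +-assoc (F 0) (∑ n (F ∘ suc)) (F (suc n))

-- Both windows complete to the same sum over `suc n` consecutive arguments, and periodicity equates
-- the two end terms, so a shift by one changes nothing.
∑-shift : ∀ n F → (∀ x → F (x + n) ≡ F x) → ∀ d → ∑ n (λ x → F (x + d)) ≡ ∑ n F
∑-shift n F per zero    = ∑-cong n (λ x → cong F (+-identityʳ x))
∑-shift n F per (suc d) = begin
  ∑ n (λ x → F (x + suc d))                      ≡⟨ ∑-cong n (λ x → cong F (+-suc x d)) ⟩
  ∑ n (G ∘ suc)                                  ≡⟨ +-cancelˡ-≡ (G 0) _ _ step ⟩
  ∑ n G                                          ≡⟨ ∑-shift n F per d ⟩
  ∑ n F                                          ∎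
  where
  open ≡-Reasoning
  G : ℕ → ℕ
  G x = F (x + d)
  step : G 0 + ∑ n (G ∘ suc) ≡ G 0 + ∑ n G
  step = begin
    G 0 + ∑ n (G ∘ suc)  ≡⟨ ∑-head n G ⟨
    ∑ n G + F (n + d)    ≡⟨ cong (∑ n G +_) (cong F (+-comm n d) ⨟ per d) ⟩
    ∑ n G + G 0          ≡⟨ +-comm (∑ n G) (G 0) ⟩
    G 0 + ∑ n G          ∎

δ : ℕ → ℕ → ℕ
δ zero    zero    = 1
δ zero    (suc _) = 0
δ (suc _) zero    = 0
δ (suc i) (suc j) = δ i j

δ-refl : ∀ i → δ i i ≡ 1
δ-refl zero    = refl
δ-refl (suc i) = δ-refl i

δ-≢ : ∀ {i j} → i ≢ j → δ i j ≡ 0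
δ-≢ {zero}  {zero}  ne = contradiction refl ne
δ-≢ {zero}  {suc j} ne = refl
δ-≢ {suc i} {zero}  ne = refl
δ-≢ {suc i} {suc j} ne = δ-≢ (ne ∘ cong suc)

occ : ℕ → List ℕ → ℕ
occ i L = sum (map (δ i) L)

occ-++ : ∀ i L M → occ i (L ++ M) ≡ occ i L + occ i M
occ-++ i L M = cong sum (map-++ (δ i) L M) ⨟ sum-++ (map (δ i) L) (map (δ i) M)

occ-↭ : ∀ i {L M} → L ↭ M → occ i L ≡ occ i M
occ-↭ i perm = sum-↭ (↭.map⁺ (δ i) perm)

occ-replicate : ∀ i m → occ i (replicate m i) ≡ m
occ-replicate i zero    = refl
occ-replicate i (suc m) = cong₂ _+_ (δ-refl i) (occ-replicate i m)

occ-absent : ∀ {i L} → All (_≢ i) L → occ i L ≡ 0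
occ-absent []         = refl
occ-absent (ne ∷ nes) = cong₂ _+_ (δ-≢ (ne ∘ sym)) (occ-absent nes)

occ-unique : ∀ i {L} → Unique L → occ i L ≤ 1
occ-unique i []                    = z≤n
occ-unique i {x ∷ L} (x∉L ∷ uniq) with i ≟ x
... | yes refl rewrite δ-refl i | occ-absent (All.map (λ ne → ne ∘ sym) x∉L) = ≤-refl
... | no i≢x rewrite δ-≢ i≢x = occ-unique i uniq

∑-δ : ∀ n (F : ℕ → ℕ) {x} → x < n → ∑ n (λ i → δ i x * F i) ≡ F x
∑-δ (suc n) F {x} (s≤s x≤n) with x ≟ n
... | yes refl = cong₂ _+_ (∑-vanish n (λ i i<n → cong (_* F i) (δ-≢ (<⇒≢ i<n))))
                           (cong (_* F n) (δ-refl n) ⨟ +-identityʳ (F n))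
... | no x≢n = cong₂ _+_ (∑-δ n F (≤∧≢⇒< x≤n x≢n)) (cong (_* F n) (δ-≢ (x≢n ∘ sym)))
                 ⨟ +-identityʳ (F x)

sum-map≡∑ : ∀ n F {L} → All (_< n) L → sum (map F L) ≡ ∑ n (λ i → occ i L * F i)
sum-map≡∑ n F []                    = sym (∑-vanish n (λ _ _ → refl))
sum-map≡∑ n F {x ∷ L} (x<n ∷ L<n) = begin
  F x + sum (map F L)
    ≡⟨ cong₂ _+_ (sym (∑-δ n F x<n)) (sum-map≡∑ n F L<n) ⟩
  ∑ n (λ i → δ i x * F i) + ∑ n (λ i → occ i L * F i)
    ≡⟨ ∑-+ n _ _ ⟨
  ∑ n (λ i → δ i x * F i + occ i L * F i)
    ≡⟨ ∑-cong n (λ i → sym (*-distribʳ-+ (F i) (δ i x) (occ i L))) ⟩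
  ∑ n (λ i → occ i (x ∷ L) * F i) ∎
  where open ≡-Reasoning

sum-map-≤ : ∀ n c F {L} → All (_< n) L → (∀ i → occ i L ≤ c) → sum (map F L) ≤ c * ∑ n F
sum-map-≤ n c F {L} L<n h = begin
  sum (map F L)                 ≡⟨ sum-map≡∑ n F L<n ⟩
  ∑ n (λ i → occ i L * F i)     ≤⟨ ∑-mono n (λ i → *-monoˡ-≤ (F i) (h i)) ⟩
  ∑ n (λ i → c * F i)           ≡⟨ ∑-*ˡ n c F ⟩
  c * ∑ n F                     ∎
  where open ≤-Reasoning

⟦_⟧ : Bool → ℕ
⟦ true ⟧  = 1
⟦ false ⟧ = 0

not-true : ∀ {b} → b ≢ true → b ≡ false
not-true {false} _ = refl
not-true {true}  h = contradiction refl h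

-- Congruence modulo p and the set of subset sums

module Mod (p : ℕ) {{_ : NonZero p}} where

  infix 4 _∼_

  _∼_ : ℕ → ℕ → Set
  x ∼ y = x % p ≡ y % p

  infixr 5 _▸_
  _▸_ : ∀ {x y z} → x ∼ y → y ∼ z → x ∼ z
  _▸_ = _⨟_

  ≡⇒∼ : ∀ {x y} → x ≡ y → x ∼ y
  ≡⇒∼ = cong (_% p)

  ∼-by : ∀ {x y} a b → x + a * p ≡ y + b * p → x ∼ y
  ∼-by {x} {y} a b eq = sym ([m+kn]%n≡m%n x a p) ⨟ cong (_% p) eq ⨟ [m+kn]%n≡m%n y b p

  ∼-+ : ∀ {x y u v} → x ∼ y → u ∼ v → x + u ∼ y + v
  ∼-+ {x} {y} {u} {v} h g =
    %-distribˡ-+ x u p ⨟ cong₂ (λ a b → (a + b) % p) h g ⨟ sym (%-distribˡ-+ y v p)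

  ∼-* : ∀ {x y u v} → x ∼ y → u ∼ v → x * u ∼ y * v
  ∼-* {x} {y} {u} {v} h g =
    %-distribˡ-* x u p ⨟ cong₂ (λ a b → (a * b) % p) h g ⨟ sym (%-distribˡ-* y v p)

  ∼-+ˡ : ∀ z {x y} → x ∼ y → z + x ∼ z + y
  ∼-+ˡ z = ∼-+ {z} {z} refl

  ∼-*ˡ : ∀ z {x y} → x ∼ y → z * x ∼ z * y
  ∼-*ˡ z = ∼-* {z} {z} refl

  %-∼ : ∀ x → x % p ∼ x
  %-∼ x = m%n%n≡m%n x p

  n*p∼0 : ∀ n → n * p ∼ 0
  n*p∼0 n = ∼-by 0 n (+-identityʳ (n * p))

  ∼⇒≡ : ∀ {x y} → x < p → y < p → x ∼ y → x ≡ y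
  ∼⇒≡ x<p y<p h = sym (m<n⇒m%n≡m x<p) ⨟ h ⨟ m<n⇒m%n≡m y<p

  0%p : 0 % p ≡ 0
  0%p = n≤0⇒n≡0 (m%n≤m 0 p)

  ∼0⇒∣ : ∀ {x} → x ∼ 0 → p ∣ x
  ∼0⇒∣ {x} h = divides (x / p) (m≡m%n+[m/n]*n x p ⨟ cong (_+ x / p * p) (h ⨟ 0%p))

  p≤ : ∀ {x} → x ∼ 0 → 0 < x → p ≤ x
  p≤ {suc x} h _ = ∣⇒≤ (∼0⇒∣ h)

  -- Multiplication by p - 1, which is -1 modulo p: negation stays in ℕ, avoids truncated
  -- subtraction and is additive as an equation of numbers.
  neg : ℕ → ℕ
  neg i = i * pred p

  +-neg : ∀ i → i + neg i ∼ 0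
  +-neg i = ≡⇒∼ (sym (*-suc i (pred p)) ⨟ cong (i *_) (suc-pred p)) ▸ n*p∼0 i

  neg-+ : ∀ i j → neg (i + j) ≡ neg i + neg j
  neg-+ i j = *-distribʳ-+ (pred p) i j

  neg-∼ : ∀ {i j} → i ∼ j → neg i ∼ neg j
  neg-∼ h = ∼-* h refl

  ∼-cancelʳ : ∀ {x y} z → x + z ∼ y + z → x ∼ y
  ∼-cancelʳ {x} {y} z h = sym (back x) ▸ ∼-+ h refl ▸ back y
    where
    back : ∀ x → (x + z) + neg z ∼ x
    back x = ≡⇒∼ (+-assoc x z (neg z)) ▸ ∼-+ˡ x (+-neg z) ▸ ≡⇒∼ (+-identityʳ x)

  ∼neg : ∀ {x i} → x + i ∼ 0 → x ∼ neg i
  ∼neg {x} {i} h = ∼-cancelʳ i (h ▸ sym (≡⇒∼ (+-comm (neg i) i) ▸ +-neg i))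

  neg-injective : ∀ {i j} → neg i ∼ neg j → i ∼ j
  neg-injective {i} {j} h = ∼-cancelʳ (neg j)
    (sym (∼-+ˡ i h) ▸ +-neg i ▸ sym (+-neg j))

  -- closes U x: some sub-multiset of U has sum ≡ −x.
  closes : List ℕ → ℕ → Bool
  closes []      x = x % p ≡ᵇ 0
  closes (u ∷ U) x = closes U x ∨ closes U (u + x)

  closes-cong : ∀ U {x y} → x ∼ y → closes U x ≡ closes U y
  closes-cong []      h = cong (_≡ᵇ 0) h
  closes-cong (u ∷ U) h = cong₂ _∨_ (closes-cong U h) (closes-cong U (∼-+ˡ u h))

  private
    x∙yz : ∀ a b c → a + (b + c) ≡ b + (a + c)
    x∙yz = solve-∀

    ∨-true : ∀ a {b} → a ∨ b ≡ true → a ≡ true ⊎ b ≡ true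
    ∨-true true  _ = inj₁ refl
    ∨-true false h = inj₂ h

  closes-keep : ∀ A U {x} → closes U x ≡ true → closes (A ++ U) x ≡ true
  closes-keep []      U     h = h
  closes-keep (a ∷ A) U {x} h rewrite closes-keep A U h = refl

  closes-add : ∀ A U {x} → closes U (sum A + x) ≡ true → closes (A ++ U) x ≡ true
  closes-add []      U     h = h
  closes-add (a ∷ A) U {x} h
    rewrite closes-add A U {a + x} (subst (λ z → closes U z ≡ true) (+-assoc a (sum A) x ⨟ x∙yz a (sum A) x) h)
    = ∨-zeroʳ (closes (A ++ U) x)

  closes-zero : ∀ U {x} → x ∼ 0 → closes U x ≡ true
  closes-zero []      {x} h = cong (_≡ᵇ 0) (h ⨟ 0%p)
  closes-zero (u ∷ U) {x} h rewrite closes-zero U h = refl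

  closes-sound : ∀ U {x} → closes U x ≡ true →
    ∃₂ λ A B → A ++ B ↭ U × sum A + x ∼ 0
  closes-sound [] {x} h = [] , [] , ↭-refl , (≡ᵇ0 h ⨟ sym 0%p)
    where
    ≡ᵇ0 : ∀ {n} → (n ≡ᵇ 0) ≡ true → n ≡ 0
    ≡ᵇ0 {zero} _ = refl
  closes-sound (u ∷ U) {x} h with ∨-true (closes U x) h
  ... | inj₁ g with closes-sound U g
  ...   | A , B , perm , z = A , u ∷ B , ↭-trans (↭.shift u A B) (prep u perm) , z
  closes-sound (u ∷ U) {x} h | inj₂ g with closes-sound U g
  ...   | A , B , perm , z =
    u ∷ A , B , prep u perm ,
    (≡⇒∼ (+-assoc u (sum A) x ⨟ x∙yz u (sum A) x) ▸ z)

  -- The residues counted are the negatives of the subset sums, equally many. Storing the sums with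
  -- this sign lets the recursion of `closes` use addition only.
  size : List ℕ → ℕ
  size U = ∑ p (λ x → ⟦ closes U x ⟧)

  private
    per : ∀ x → x + p ∼ x
    per x = [m+n]%n≡m%n x p

  -- The autocorrelation of the sumset: its pairs of points with difference `d`.
  common : List ℕ → ℕ → ℕ
  common U d = ∑ p (λ x → ⟦ closes U x ⟧ * ⟦ closes U (d + x) ⟧)

  -- Inclusion-exclusion: the new sumset is the union of the old one and a translate, and
  -- `common U u` measures their overlap.
  size-∷ : ∀ u U → size (u ∷ U) + common U u ≡ size U + size U
  size-∷ u U = begin
    size (u ∷ U) + common U u
      ≡⟨ ∑-+ p _ _ ⟨
    ∑ p (λ x → ⟦ closes U x ∨ closes U (u + x) ⟧ + ⟦ closes U x ⟧ * ⟦ closes U (u + x) ⟧)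
      ≡⟨ ∑-cong p (λ x → incl-excl (closes U x) (closes U (u + x))) ⟩
    ∑ p (λ x → ⟦ closes U x ⟧ + ⟦ closes U (u + x) ⟧)
      ≡⟨ ∑-+ p _ _ ⟩
    size U + ∑ p (λ x → ⟦ closes U (u + x) ⟧)
      ≡⟨ cong (size U +_) shifted ⟩
    size U + size U ∎
    where
    open ≡-Reasoning
    incl-excl : ∀ a b → ⟦ a ∨ b ⟧ + ⟦ a ⟧ * ⟦ b ⟧ ≡ ⟦ a ⟧ + ⟦ b ⟧
    incl-excl true  true  = refl
    incl-excl true  false = refl
    incl-excl false true  = refl
    incl-excl false false = refl
    shifted : ∑ p (λ x → ⟦ closes U (u + x) ⟧) ≡ size U
    shifted = ∑-cong p (λ x → cong (⟦_⟧ ∘ closes U) (+-comm u x))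
      ⨟ ∑-shift p (⟦_⟧ ∘ closes U) (λ x → cong ⟦_⟧ (closes-cong U (per x))) u

  -- Double counting: each ordered pair of points has exactly one difference modulo p.
  common-sum : ∀ U → ∑ p (common U) ≡ size U * size U
  common-sum U = begin
    ∑ p (λ d → ∑ p (λ x → c x * c (d + x)))   ≡⟨ ∑-swap p p _ ⟩
    ∑ p (λ x → ∑ p (λ d → c x * c (d + x)))   ≡⟨ ∑-cong p (λ x → ∑-*ˡ p (c x) _) ⟩
    ∑ p (λ x → c x * ∑ p (λ d → c (d + x)))
      ≡⟨ ∑-cong p (λ x → cong (c x *_) (∑-shift p c (λ y → cong ⟦_⟧ (closes-cong U (per y))) x)) ⟩
    ∑ p (λ x → c x * size U)                  ≡⟨ ∑-*ʳ p (size U) c ⟩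
    size U * size U                           ∎
    where
    open ≡-Reasoning
    c : ℕ → ℕ
    c x = ⟦ closes U x ⟧

  common-zero : ∀ U → common U 0 ≡ size U
  common-zero U = ∑-cong p (λ x → idem (closes U x))
    where
    idem : ∀ b → ⟦ b ⟧ * ⟦ b ⟧ ≡ ⟦ b ⟧
    idem true  = refl
    idem false = refl

  common-neg : ∀ U {d e} → d + e ∼ 0 → common U d ≡ common U e
  common-neg U {d} {e} h = begin
    ∑ p (λ x → c x * c (d + x))
      ≡⟨ ∑-shift p (λ x → c x * c (d + x))
           (λ x → cong₂ _*_ (c-cong (per x)) (c-cong (∼-+ˡ d (per x)))) e ⟨
    ∑ p (λ x → c (x + e) * c (d + (x + e)))
      ≡⟨ ∑-cong p (λ x → cong₂ _*_ (cong c (+-comm x e))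
           (c-cong (≡⇒∼ (x∙yz d x e) ▸ ∼-+ˡ x h ▸ ≡⇒∼ (+-identityʳ x)))) ⟩
    ∑ p (λ x → c (e + x) * c x)
      ≡⟨ ∑-cong p (λ x → *-comm (c (e + x)) (c x)) ⟩
    ∑ p (λ x → c x * c (e + x)) ∎
    where
    open ≡-Reasoning
    c : ℕ → ℕ
    c x = ⟦ closes U x ⟧
    c-cong : ∀ {x y} → x ∼ y → c x ≡ c y
    c-cong = cong ⟦_⟧ ∘ closes-cong U

  private
    points : ∀ {F : ℕ → ℕ} → (∀ {x y} → x ∼ y → F x ≡ F y) → ∀ {L} →
      Unique (map (_% p) L) → All (λ x → 1 ≤ F x) L → length L ≤ ∑ p F
    points {F} F-cong {L} uniq ones = begin
      length L                    ≤⟨ count ones ⟩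
      sum (map F (map (_% p) L))  ≤⟨ sum-map-≤ p 1 F (All.map⁺ (All.universal (λ x → m%n<n x p) L)) (λ i → occ-unique i uniq) ⟩
      1 * ∑ p F                   ≡⟨ *-identityˡ (∑ p F) ⟩
      ∑ p F                       ∎
      where
      open ≤-Reasoning
      count : ∀ {L} → All (λ x → 1 ≤ F x) L → length L ≤ sum (map F (map (_% p) L))
      count []               = z≤n
      count {x ∷ _} (h ∷ hs) = +-mono-≤ (subst (1 ≤_) (sym (F-cong (%-∼ x))) h) (count hs)

  size-≥ : ∀ U {L} → Unique (map (_% p) L) → All (λ x → closes U x ≡ true) L → length L ≤ size U
  size-≥ U uniq = points (cong ⟦_⟧ ∘ closes-cong U) uniq ∘ All.map (λ h → ≡⇒≥ (cong ⟦_⟧ h))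

  size-gaps : ∀ U {L} → Unique (map (_% p) L) → All (λ x → closes U x ≡ false) L →
    size U + length L ≤ p
  size-gaps U {L} uniq gaps = begin
    size U + length L                                       ≤⟨ +-monoʳ-≤ (size U) outside ⟩
    size U + ∑ p (λ x → ⟦ not (closes U x) ⟧)               ≡⟨ ∑-+ p _ _ ⟨
    ∑ p (λ x → ⟦ closes U x ⟧ + ⟦ not (closes U x) ⟧)       ≡⟨ ∑-cong p (λ x → either (closes U x)) ⟩
    ∑ p (λ _ → 1)                                           ≡⟨ ∑-one p ⟩
    p                                                       ∎
    where
    open ≤-Reasoning
    either : ∀ b → ⟦ b ⟧ + ⟦ not b ⟧ ≡ 1
    either true  = refl
    either false = refl
    outside : length L ≤ ∑ p (λ x → ⟦ not (closes U x) ⟧)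
    outside = points (cong (⟦_⟧ ∘ not) ∘ closes-cong U) uniq (All.map (λ h → ≡⇒≥ (cong (⟦_⟧ ∘ not) h)) gaps)

  size-grows : ∀ u U {L} → Unique (map (_% p) L) →
    All (λ x → closes U x ≡ false × closes U (u + x) ≡ true) L →
    size U + length L ≤ size (u ∷ U)
  size-grows u U {L} uniq new = begin
    size U + length L                    ≤⟨ +-monoʳ-≤ (size U) fresh ⟩
    size U + ∑ p (λ x → ⟦ r x ⟧)         ≡⟨ ∑-+ p _ _ ⟨
    ∑ p (λ x → ⟦ closes U x ⟧ + ⟦ r x ⟧) ≡⟨ ∑-cong p (λ x → split (closes U x) (closes U (u + x))) ⟩
    size (u ∷ U)                         ∎
    where
    open ≤-Reasoning
    r : ℕ → Bool
    r x = not (closes U x) ∧ closes U (u + x)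
    r-cong : ∀ {x y} → x ∼ y → r x ≡ r y
    r-cong h = cong₂ (λ a b → not a ∧ b) (closes-cong U h) (closes-cong U (∼-+ˡ u h))
    split : ∀ a b → ⟦ a ⟧ + ⟦ not a ∧ b ⟧ ≡ ⟦ a ∨ b ⟧
    split true  b = refl
    split false b = refl
    rising : ∀ {x} → closes U x ≡ false × closes U (u + x) ≡ true → 1 ≤ ⟦ r x ⟧
    rising (h , g) rewrite h | g = ≤-refl
    fresh : length L ≤ ∑ p (λ x → ⟦ r x ⟧)
    fresh = points (cong ⟦_⟧ ∘ r-cong) uniq (All.map rising new)

-- Prime modulus: a sumset that grows by one point is a progression

replicate-All : ∀ {b : ℕ} {L} → All (_≡ b) L → L ≡ replicate (length L) b
replicate-All []           = refl
replicate-All (refl ∷ eqs) = cong (_ ∷_) (replicate-All eqs)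

replicate-+ : ∀ m n (b : ℕ) → replicate (m + n) b ≡ replicate m b ++ replicate n b
replicate-+ zero    n b = refl
replicate-+ (suc m) n b = cong (b ∷_) (replicate-+ m n b)

sum-replicate : ∀ m b → sum (replicate m b) ≡ m * b
sum-replicate zero    b = refl
sum-replicate (suc m) b = cong (b +_) (sum-replicate m b)

pick : ∀ {x : ℕ} {L} → x ∈ L → ∃ λ M → L ↭ x ∷ M
pick {x} x∈L with ∈-∃++ x∈L
... | A , B , refl = A ++ B , ↭.shift x A B

-- Scanning upwards finds the first switch from `false` to `true`. Along the multiples of b, such a
-- switch is a sum newly gained by adding b.
rise : ∀ (h : ℕ → Bool) n j → h j ≡ false → h (n + j) ≡ true →
  ∃ λ k → j ≤ k × k < n + j × h (suc k) ≡ true × (∀ i → j ≤ i → i ≤ k → h i ≡ false)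
rise h zero    j hj≡f hj≡t = contradiction (sym hj≡f ⨟ hj≡t) λ ()
rise h (suc n) j hj≡f end with h (suc j) in eq
... | true  = j , ≤-refl , s≤s (m≤n+m j n) , eq ,
              λ i j≤i i≤j → subst (λ z → h z ≡ false) (≤-antisym j≤i i≤j) hj≡f
... | false with rise h n (suc j) eq (subst (λ z → h z ≡ true) (sym (+-suc n j)) end)
...   | k , j<k , k< , top , below =
  k , <⇒≤ j<k , subst (k <_) (+-suc n j) k< , top , before
  where
  before : ∀ i → j ≤ i → i ≤ k → h i ≡ false
  before i j≤i i≤k with j ≟ i
  ... | yes refl = hj≡f
  ... | no j≢i   = below i (≤∧≢⇒< j≤i j≢i) i≤k

module Residues (p : ℕ) {{_ : NonZero p}} (p-prime : Prime p) where

  open Mod p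

  unique-% : ∀ (f : ℕ → ℕ) n → (∀ {i j} → i < j → j < n → ¬ f i ∼ f j) →
    Unique (map (_% p) (applyUpTo f n))
  unique-% f n inj = subst Unique (sym (map-applyUpTo f (_% p) n)) (Unique.applyUpTo⁺₁ _ n inj)

  inverse : ∀ {c} → ¬ c ∼ 0 → ∃ λ d → d * c ∼ 1
  inverse {c} c≁0 with coprime-Bézout (prime⇒coprime p-prime {{≢-nonZero λ z → c≁0 (z ⨟ sym 0%p)}} (m%n<n c p))
  ... | Bézout.-+ x y eq = y , (∼-*ˡ y (sym (%-∼ c)) ▸ ≡⇒∼ (sym eq) ▸ ∼-+ˡ 1 (n*p∼0 x))
  -- In this case y c is congruent to -1.
  ... | Bézout.+- x y eq = neg y , ∼-cancelʳ (y * c)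
    (≡⇒∼ (neg-y y (pred p) c) ▸ ∼-*ˡ c (+-neg y) ▸ ≡⇒∼ (*-zeroʳ c)
     ▸ sym (∼-+ˡ 1 (∼-*ˡ y (sym (%-∼ c))) ▸ ≡⇒∼ eq ▸ n*p∼0 x))
    where
    neg-y : ∀ y q c → y * q * c + y * c ≡ c * (y + y * q)
    neg-y = solve-∀

  ∼-cancel-* : ∀ {c x y} → ¬ c ∼ 0 → x * c ∼ y * c → x ∼ y
  ∼-cancel-* {c} {x} {y} c≁0 h with inverse c≁0
  ... | d , dc∼1 = sym (undo x) ▸ ∼-*ˡ d h ▸ undo y
    where
    rot : ∀ d x c → d * (x * c) ≡ x * (d * c)
    rot = solve-∀
    undo : ∀ x → d * (x * c) ∼ x
    undo x = ≡⇒∼ (rot d x c) ▸ ∼-*ˡ x dc∼1 ▸ ≡⇒∼ (*-identityʳ x)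

  ≁0 : ∀ {x} → 1 ≤ x → x < p → ¬ x ∼ 0
  ≁0 1≤x x<p h = <⇒≱ x<p (p≤ h 1≤x)

  size-multiples : ∀ {b} U n → ¬ b ∼ 0 → n < p →
    (∀ i → 1 ≤ i → i ≤ n → closes U (i * b) ≡ false) → size U + n ≤ p
  size-multiples {b} U n b≁0 n<p h =
    subst (λ z → size U + z ≤ p) (length-applyUpTo (λ i → suc i * b) n)
      (size-gaps U (unique-% (λ i → suc i * b) n distinct)
        (All.applyUpTo⁺₁ _ n (λ {i} i<n → h (suc i) (s≤s z≤n) i<n)))
    where
    distinct : ∀ {i j} → i < j → j < n → ¬ suc i * b ∼ suc j * b
    distinct i<j j<n eq = <⇒≢ i<j (suc-injective
      (∼⇒≡ (≤-<-trans (<-trans i<j j<n) n<p) (≤-<-trans j<n n<p) (∼-cancel-* b≁0 eq)))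

  two-rises : ∀ {d x y} U → size (d ∷ U) ≤ suc (size U) → ¬ x ∼ y →
    closes U x ≡ false → closes U (d + x) ≡ true →
    closes U y ≡ false → closes U (d + y) ≡ true → ⊥
  two-rises {d} U slow x≁y x₀ x₁ y₀ y₁ =
    absurd 0 (≤-trans (size-grows d U ((x≁y ∷ []) ∷ [] ∷ []) ((x₀ , x₁) ∷ (y₀ , y₁) ∷ [])) slow)
      (arith (size U))
    where
    arith : ∀ s → s + 2 ≡ suc (suc s + 0)
    arith = solve-∀

  -- If adding b enlarges the sumset by one point only, the sumset is a progression
  -- with difference b; such a progression determines b up to sign.
  same-step : ∀ {b c} U → ¬ b ∼ 0 → ¬ c ∼ 0 → closes U b ≡ false → closes U c ≡ false →
    size (b ∷ U) ≤ suc (size U) → size (c ∷ U) ≤ suc (size U) → 2 ≤ size U → c ∼ b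
  same-step {b} {c} U b≁0 c≁0 b-free c-free slow-b slow-c big
    = progression (inverse b≁0) (rise h (pred p) 1 (closes-cong U (≡⇒∼ (+-identityʳ b)) ⨟ b-free) (cong h end ⨟ h-p))
    where
    h : ℕ → Bool
    h k = closes U (k * b)

    end : pred p + 1 ≡ p
    end = +-comm (pred p) 1 ⨟ suc-pred p

    h-p : h p ≡ true
    h-p = closes-zero U (≡⇒∼ (*-comm p b) ▸ n*p∼0 b)

    progression : (∃ λ b' → b' * b ∼ 1) →
      (∃ λ e → 1 ≤ e × e < pred p + 1 × h (suc e) ≡ true × (∀ i → 1 ≤ i → i ≤ e → h i ≡ false)) → c ∼ b
    progression (b' , b'b∼1) (e , 1≤e , e<end , top , below) = finish k (m%n<n _ p) kb∼c
      where
      e<p : e < p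
      e<p = subst (e <_) end e<end

      -- A hole beyond e would give a second switch, hence a second new sum. So the missing
      -- multiples of b are exactly those from 1 to e.
      after : ∀ j → e < j → j ≤ p → h j ≡ true
      after j e<j j≤p with h j in eq
      ... | true  = refl
      ... | false with rise h (p ∸ j) j eq (subst (λ z → h z ≡ true) (sym (m∸n+n≡m j≤p)) h-p)
      ...   | f , j≤f , f<p , top' , below' = ⊥-elim (two-rises U slow-b
                (λ eq → <⇒≢ (<-≤-trans e<j j≤f)
                  (∼⇒≡ (e<p) (subst (f <_) (m∸n+n≡m j≤p) f<p) (∼-cancel-* b≁0 eq)))
                (below e 1≤e ≤-refl) top (below' f j≤f ≤-refl) top')

      k : ℕ
      k = (c * b') % p

      kb∼c : k * b ∼ c
      kb∼c = ∼-* (%-∼ (c * b')) refl ▸ ≡⇒∼ (*-assoc c b' b) ▸ ∼-*ˡ c b'b∼1 ▸ ≡⇒∼ (*-identityʳ c)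

      -- If e + 1 were p, all nonzero residues would be missing, against `size U` ≥ 2.
      two≤ : suc (suc e) ≤ p
      two≤ with suc e ≟ p
      ... | no ne  = ≤∧≢⇒< (e<p) ne
      ... | yes eq = absurd 0 (≤-trans (big ⊕ ≤-refl)
                       (size-multiples U e b≁0 (e<p) below)) (cong suc (eq ⨟ sym (+-identityʳ p)))

      finish : ∀ k → k < p → k * b ∼ c → c ∼ b
      finish zero       k<p kb∼c = contradiction (sym kb∼c) c≁0
      finish (suc zero) k<p kb∼c = sym kb∼c ▸ ≡⇒∼ (+-identityʳ b)
      finish k@(suc (suc k')) k<p kb∼c with k ≤? e
      ... | no k≰e = contradiction (sym (after k (≰⇒> k≰e) (<⇒≤ k<p)) ⨟ closes-cong U kb∼c ⨟ c-free) λ ()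
      -- For 2 ≤ k ≤ e, translation by c = k b carries the positions e - k + 1 and e - k + 2 out of
      -- the gap, to e + 1 and e + 2: two new sums at once.
      ... | yes k≤e with m≤n⇒∃[o]m+o≡n k≤e
      ...   | o , refl = ⊥-elim (two-rises U slow-c
                (λ eq → <⇒≢ (n<1+n (suc o)) (∼⇒≡ (<-trans (n<1+n _) o₂<p) o₂<p (∼-cancel-* b≁0 eq)))
                (below (suc o) (s≤s z≤n) (<⇒≤ o₂≤e)) (shifted (suc o) (+-suc k o) ⨟ top)
                (below (suc (suc o)) (s≤s z≤n) o₂≤e)
                (shifted (suc (suc o)) (+-suc k (suc o) ⨟ cong suc (+-suc k o))
                  ⨟ after (suc (suc e)) (s≤s (n≤1+n e)) two≤))
        where
        o₂≤e : suc (suc o) ≤ suc (suc (k' + o))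
        o₂≤e = s≤s (s≤s (m≤n+m o k'))
        o₂<p : suc (suc o) < p
        o₂<p = ≤-<-trans o₂≤e (e<p)
        shifted : ∀ x {y} → k + x ≡ y → closes U (c + x * b) ≡ h y
        shifted x refl = closes-cong U (∼-+ (sym kb∼c) refl ▸ ≡⇒∼ (sym (*-distribʳ-+ b k x)))

-- Minimal zero-sum sequences and greedy growth of the sumset

module Sequences (p : ℕ) {{_ : NonZero p}} (p-prime : Prime p) where

  open Mod p
  open Residues p p-prime

  -- A proper nonempty subsequence appears as `u ∷ U` with nonempty complement `r ∷ R`; this is why
  -- later statements carry a spare outside term.
  record MinimalZeroSum (T : List ℕ) : Set where
    field
      range   : All (λ x → 1 ≤ x × x < p) T
      total   : sum T ∼ 0
      minimal : ∀ {u U r R} → u ∷ U ++ r ∷ R ↭ T → ¬ sum (u ∷ U) ∼ 0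
      long    : p ≤ 1 + 2 * length T

  module _ {T : List ℕ} (mzs : MinimalZeroSum T) where

    open MinimalZeroSum mzs

    -- A sub-multiset A of U closing up W would, together with W, form a nonempty zero-sum
    -- subsequence that misses `r`.
    free : ∀ {w r} W U R → w ∷ W ++ U ++ r ∷ R ↭ T → closes U (sum (w ∷ W)) ≡ false
    free {w} {r} W U R perm = not-true closed
      where
      comm : ∀ w W A → w + (W + A) ≡ A + (w + W)
      comm = solve-∀
      closed : closes U (sum (w ∷ W)) ≢ true
      closed h with closes-sound U h
      ... | A , B , AB↭U , z = minimal {w} {W ++ A} {r} {R ++ B}
        (↭-trans (rearrange 6 (λ w W A r R B → (w ∪ W ∪ A) ∪ (r ∪ R ∪ B) ≐ (w ∪ W) ∪ (A ∪ B) ∪ r ∪ R)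
                   ↭-refl (w ◂ ∅) W A (r ◂ ∅) R B)
          (↭-trans (prep w (↭.++⁺ˡ W (↭.++⁺ʳ (r ∷ R) AB↭U))) perm))
        (≡⇒∼ (cong (w +_) (sum-++ W A) ⨟ comm w (sum W) (sum A)) ▸ z)

    in-range : ∀ {x L} → x ∷ L ↭ T → 1 ≤ x × x < p
    in-range perm = All.head (↭.All-resp-↭ (↭-sym perm) range)

    in≁0 : ∀ {x L} → x ∷ L ↭ T → ¬ x ∼ 0
    in≁0 perm = let (1≤x , x<p) = in-range perm in ≁0 1≤x x<p

    private
      front : ∀ A x (B : List ℕ) → x ∷ A ++ B ↭ A ++ x ∷ B
      front A x B = ↭-sym (↭.shift x A B)

      -- At most one term outside U gives p ≤ 2|U| + 3, while U already has 2|U| + 4 sums.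
      too-long : ∀ s u → 4 + 2 * u ≤ s → ∀ t → t ≤ suc u → s ≤ p → p ≤ 1 + 2 * t → ⊥
      too-long s u h t t≤ s≤p p≤ = absurd 0 (h ⊕ s≤p ⊕ p≤ ⊕ 2 ⊗ t≤) (arith s u t p)
        where
        arith : ∀ s u t p → 4 + 2 * u + s + p + 2 * t ≡ suc (s + p + (1 + 2 * t) + 2 * suc u + 0)
        arith = solve-∀

      size≤p : ∀ U → size U ≤ p
      size≤p U = ≤-trans (m≤m+n (size U) 0) (size-gaps U {[]} [] [])

      -- `same-step` makes all m remaining terms equal to b. One of them stays outside, so b, ...,
      -- (m - 1)b are missing residues, and `size U` + m - 1 ≤ p ≤ 1 + 2(|U| + m). This is the
      -- origin of the constant in the bound.
      stuck : ∀ {U R} → U ++ R ↭ T → 4 + 2 * length U ≤ size U →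
        All (λ r → size (r ∷ U) ≤ suc (size U)) R →
        ∃₂ λ b m → R ≡ replicate m b × size U ≤ 2 + 2 * length U + m
      stuck {U} {[]} perm big slow = ⊥-elim (too-long (size U) (length U) big (length T)
        (≤-trans (≡⇒≤ (sym (↭.↭-length perm) ⨟ length-++ U ⨟ +-identityʳ (length U))) (n≤1+n _)) (size≤p U) long)
      stuck {U} {r ∷ []} perm big slow = ⊥-elim (too-long (size U) (length U) big (length T)
        (≡⇒≤ (sym (↭.↭-length perm) ⨟ length-++ U ⨟ +-comm (length U) 1)) (size≤p U) long)
      stuck {U} {b ∷ c ∷ R} perm big (slow-b ∷ slow) =
        b , suc n , cong (b ∷_) constant , bound
        where
        n : ℕ
        n = length (c ∷ R)

        perm-b : b ∷ U ++ c ∷ R ↭ T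
        perm-b = ↭-trans (front U b (c ∷ R)) perm

        b-free : closes U b ≡ false
        b-free = closes-cong U (≡⇒∼ (sym (+-identityʳ b))) ⨟ free [] U R perm-b

        two≤ : 2 ≤ size U
        two≤ = ≤-trans (s≤s (s≤s z≤n)) big

        is-b : ∀ {r} → r ∈ c ∷ R → size (r ∷ U) ≤ suc (size U) → r ≡ b
        is-b {r} r∈ slow-r with pick r∈
        ... | M , cR↭rM = ∼⇒≡ (proj₂ (in-range perm-r)) (proj₂ (in-range perm-b))
          (same-step U (in≁0 perm-b) (in≁0 perm-r) b-free
            (closes-cong U (≡⇒∼ (sym (+-identityʳ r))) ⨟ free [] U M perm-r) slow-b slow-r two≤)
          where
          perm-r : r ∷ U ++ b ∷ M ↭ T
          perm-r = ↭-trans (front U r (b ∷ M))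
            (↭-trans (↭.++⁺ˡ U (↭-trans (swap r b ↭-refl) (prep b (↭-sym cR↭rM)))) perm)

        constant : c ∷ R ≡ replicate n b
        constant = replicate-All (All.tabulate λ r∈ → is-b r∈ (All.lookup slow r∈))

        free-multiples : ∀ i → 1 ≤ i → i ≤ n → closes U (i * b) ≡ false
        free-multiples (suc i) _ i≤n with m≤n⇒∃[o]m+o≡n i≤n
        ... | o , eq = cong (closes U) (sym (sum-replicate (suc i) b)) ⨟
          free {b} {b} (replicate i b) U (replicate o b)
            (↭-trans (rearrange 4 (λ x W U R → (x ∪ W) ∪ U ∪ x ∪ R ≐ U ∪ x ∪ (x ∪ W) ∪ R)
                        ↭-refl (b ◂ ∅) (replicate i b) U (replicate o b))
              (subst (λ L → U ++ b ∷ L ↭ T)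
                (constant ⨟ cong (λ m → replicate m b) (sym eq) ⨟ replicate-+ (suc i) o b) perm))

        -- Otherwise p b ≡ 0 would be among the missing multiples.
        n<p : n < p
        n<p with n <? p
        ... | yes h = h
        ... | no ¬h = contradiction
          (sym (free-multiples p (>-nonZero⁻¹ p) (≮⇒≥ ¬h)) ⨟ closes-zero U (≡⇒∼ (*-comm p b) ▸ n*p∼0 b)) λ ()

        bound : size U ≤ 2 + 2 * length U + suc n
        bound = linear 0 (size-multiples U n (in≁0 perm-b) n<p free-multiples ⊕ long
                           ⊕ 2 ⊗ ≡⇒≤ (sym (↭.↭-length perm) ⨟ length-++ U))
                  (arith (size U) n p (length T) (length U))
          where
          arith : ∀ s n p t u → s + (p + (1 + 2 * t) + 2 * (u + suc n)) + 0
                                ≡ 2 + 2 * u + suc n + (s + n + p + 2 * t)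
          arith = solve-∀

    -- Each absorbed term raises `size U` by at least 2 and 2|U| by exactly 2, so the hypothesis
    -- passes on to the longer U and the final bound passes back. The number `n` bounds the
    -- recursion.
    extend : ∀ n {U R} → length R ≤ n → U ++ R ↭ T → 4 + 2 * length U ≤ size U →
      ∃₂ λ b m → ∃ λ R' → U ++ replicate m b ++ R' ↭ T × size U ≤ 2 + 2 * length U + m
    extend n {U} {R} len perm big with any? (λ r → 2 + size U ≤? size (r ∷ U)) R
    ... | no none with stuck perm big (All.map (λ h → ≤-pred (≰⇒> h)) (All.¬Any⇒All¬ R none))
    ...   | b , m , refl , bound = b , m , [] , ↭-trans (↭.++⁺ˡ U (↭.++-identityʳ _)) perm , bound
    extend n {U} {R} len perm big | yes some with find some
    ... | r , r∈R , grows with pick r∈R | n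
    ...   | M , R↭rM | zero = contradiction (≤-trans (≡⇒≥ (↭.↭-length R↭rM)) len) λ ()
    ...   | M , R↭rM | suc n'
      with extend n' {r ∷ U} {M} (≤-pred (≤-trans (≡⇒≥ (↭.↭-length R↭rM)) len))
             (↭-trans (front U r M) (↭-trans (↭.++⁺ˡ U (↭-sym R↭rM)) perm))
             (linear 0 (big ⊕ grows) (arith (size U) (length U) (size (r ∷ U))))
      where
      arith : ∀ s u t → 4 + 2 * suc u + (s + t) + 0 ≡ t + (4 + 2 * u + (2 + s))
      arith = solve-∀
    ...     | b , m , R' , perm' , bound =
      b , m , r ∷ R' ,
      ↭-trans (rearrange 4 (λ U B r R → U ∪ B ∪ r ∪ R ≐ (r ∪ U) ∪ B ∪ R) ↭-refl U (replicate m b) (r ◂ ∅) R') perm' ,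
      linear 0 (grows ⊕ bound) (arith' (size U) (length U) (size (r ∷ U)) m)
      where
      arith' : ∀ s u t m → s + (t + (2 + 2 * suc u + m)) + 0 ≡ 2 + 2 * u + m + (2 + s + t)
      arith' = solve-∀

-- A value of multiplicity at least 8

occ-∈ : ∀ {i L} → i ∈ L → 1 ≤ occ i L
occ-∈ {i} {L} (here refl) rewrite δ-refl i = s≤s z≤n
occ-∈ {i} {x ∷ L} (there i∈L) = ≤-trans (occ-∈ i∈L) (m≤n+m (occ i L) (δ i x))

occ-positive : ∀ i L → 1 ≤ occ i L → i ∈ L
occ-positive i (x ∷ L) h with i ≟ x
... | yes refl = here refl
... | no i≢x   = there (occ-positive i L (subst (λ z → 1 ≤ z + occ i L) (δ-≢ i≢x) h))

occ-∉ : ∀ i L → ¬ 1 ≤ occ i L → occ i L ≡ 0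
occ-∉ i L h = n<1⇒n≡0 (≰⇒> h)

-- If a sumset of size n ≥ N never grew beyond N' when one of the other 73 or more
-- elements is added, counting pairs of points by their difference would refute this.
Grows : ℕ → ℕ → Set
Grows N N' = ∀ {n} → n < suc N' → N ≤ n → 7 * (n * n) < 2 * (73 * (2 * n ∸ N')) + 7 * n

grows? : ∀ N N' → Dec (Grows N N')
grows? N N' = allUpTo? (λ n → (N ≤? n) →-dec (7 * (n * n) <? 2 * (73 * (2 * n ∸ N')) + 7 * n)) (suc N')

-- The guaranteed sizes run 1, 2, 4, 8, 14, 20 over five added terms; the arguments are the current
-- size and the next size less one.
grows₁ : Grows 1 1
grows₁ = from-yes (grows? 1 1)

grows₂ : Grows 2 3
grows₂ = from-yes (grows? 2 3)

grows₃ : Grows 4 7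
grows₃ = from-yes (grows? 4 7)

grows₄ : Grows 8 13
grows₄ = from-yes (grows? 8 13)

grows₅ : Grows 14 19
grows₅ = from-yes (grows? 14 19)

module Multiplicity (p : ℕ) {{_ : NonZero p}} (p-prime : Prime p) where

  open Mod p
  open Residues p p-prime
  open Sequences p p-prime

  Multiplicities≤ : ℕ → List ℕ → Set
  Multiplicities≤ α T = ∀ i → occ i T ≤ α

  size-bound : ∀ {T α} → MinimalZeroSum T → Multiplicities≤ α T → 1 ≤ α →
    ∀ U R → U ++ R ↭ T → size U ≤ 2 + 2 * length U + α
  size-bound {T} {α} mzs mult 1≤α U R perm with 4 + 2 * length U ≤? size U
  -- Here `size U` ≤ 2|U| + 3, and α ≥ 1 suffices.
  ... | no small = linear 0 (≰⇒> small ⊕ 1≤α) (arith (size U) (length U) α)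
    where
    arith : ∀ s u a → s + (4 + 2 * u + a) + 0 ≡ 2 + 2 * u + a + (suc s + 1)
    arith = solve-∀
  ... | yes big with extend mzs (length R) {U} {R} ≤-refl perm big
  ...   | b , m , R' , perm' , bound = ≤-trans bound (+-monoʳ-≤ (2 + 2 * length U) (begin
    m                                             ≡⟨ occ-replicate b m ⟨
    occ b (replicate m b)                         ≤⟨ m≤m+n _ _ ⟩
    occ b (replicate m b) + occ b R'              ≤⟨ m≤n+m _ (occ b U) ⟩
    occ b U + (occ b (replicate m b) + occ b R')  ≡⟨ cong (occ b U +_) (occ-++ b (replicate m b) R') ⟨
    occ b U + occ b (replicate m b ++ R')         ≡⟨ occ-++ b U _ ⟨
    occ b (U ++ replicate m b ++ R')              ≡⟨ occ-↭ b perm' ⟩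
    occ b T                                       ≤⟨ mult b ⟩
    α                                             ∎))
    where open ≤-Reasoning

  module _ {T} (mzs : MinimalZeroSum T) (157≤p : 157 ≤ p) where

    open MinimalZeroSum mzs

    private
      78≤T : 78 ≤ length T
      78≤T = *-cancelˡ-≤ {78} {length T} 2 (≤-pred (≤-trans 157≤p long))

      2≁0 : ¬ 2 ∼ 0
      2≁0 = ≁0 (s≤s z≤n) (≤-trans (from-yes (3 ≤? 157)) 157≤p)

      -- Two different entries would form a proper zero-sum subsequence; one entry used twice would
      -- be annihilated by 2.
      no-opposites : ∀ U {R r i} → U ++ R ↭ T → r ∈ R → i ∈ R → r + i ∼ 0 → ⊥
      no-opposites U {R} {r} {i} perm r∈R i∈R opp with pick r∈R
      ... | M , R↭rM with ↭.∈-resp-↭ R↭rM i∈R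
      ...   | here refl = in≁0 mzs perm-r (∼-cancel-* 2≁0 (≡⇒∼ (double r) ▸ opp))
        where
        double : ∀ r → r * 2 ≡ r + r
        double = solve-∀
        perm-r : r ∷ U ++ M ↭ T
        perm-r = ↭-trans (↭-sym (↭.shift r U M)) (↭-trans (↭.++⁺ˡ U (↭-sym R↭rM)) perm)
      ...   | there i∈M with pick i∈M
      ...     | N , M↭iN = rest (U ++ N) perm-ri
        where
        perm-ri : r ∷ i ∷ U ++ N ↭ T
        perm-ri = ↭-trans (rearrange 4 (λ r i U N → r ∪ i ∪ U ∪ N ≐ U ∪ r ∪ i ∪ N) ↭-refl (r ◂ ∅) (i ◂ ∅) U N)
          (↭-trans (↭.++⁺ˡ U (↭-trans (prep r (↭-sym M↭iN)) (↭-sym R↭rM))) perm)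
        rest : ∀ L → r ∷ i ∷ L ↭ T → ⊥
        rest []      perm = <⇒≱ (from-yes (2 <? 78)) (≤-trans 78≤T (≡⇒≤ (sym (↭.↭-length perm))))
        rest (x ∷ L) perm = minimal {r} {i ∷ []} perm (≡⇒∼ (cong (r +_) (+-identityʳ i)) ▸ opp)

    -- R and −R are disjoint because T has no two opposite terms, so together with seven
    -- zeros they still take each value at most 7 times.
    common-bound : Multiplicities≤ 7 T → ∀ {U R} → U ++ R ↭ T →
      2 * sum (map (common U) R) + 7 * size U ≤ 7 * (size U * size U)
    common-bound mult {U} {R} perm = begin
      2 * sum (map F R) + 7 * size U
        ≡⟨ cong₂ _+_ (cong (sum (map F R) +_) (+-identityʳ _)) refl ⟩
      sum (map F R) + sum (map F R) + 7 * size U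
        ≡⟨ cong (λ z → sum (map F R) + z + 7 * size U) (mirrored R-range) ⟨
      sum (map F R) + sum (map F -R) + 7 * size U
        ≡⟨ cong (λ z → sum (map F R) + sum (map F -R) + 7 * z) (common-zero U) ⟨
      sum (map F R) + sum (map F -R) + sum (map F (replicate 7 0))
        ≡⟨ +-assoc (sum (map F R)) _ _ ⟩
      sum (map F R) + (sum (map F -R) + sum (map F (replicate 7 0)))
        ≡⟨ cong (sum (map F R) +_) (map-sum -R _) ⟨
      sum (map F R) + sum (map F (-R ++ replicate 7 0))
        ≡⟨ map-sum R _ ⟨
      sum (map F (R ++ -R ++ replicate 7 0))
        ≤⟨ sum-map-≤ p 7 F small occurrences ⟩
      7 * ∑ p F
        ≡⟨ cong (7 *_) (common-sum U) ⟩
      7 * (size U * size U) ∎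
      where
      open ≤-Reasoning
      F : ℕ → ℕ
      F = common U
      -R : List ℕ
      -R = map (p ∸_) R
      map-sum : ∀ L M → sum (map F (L ++ M)) ≡ sum (map F L) + sum (map F M)
      map-sum L M = cong sum (map-++ F L M) ⨟ sum-++ (map F L) (map F M)
      R-range : All (λ x → 1 ≤ x × x < p) R
      R-range = All.++⁻ʳ U (↭.All-resp-↭ (↭-sym perm) range)
      mirrored : ∀ {L} → All (λ x → 1 ≤ x × x < p) L → sum (map F (map (p ∸_) L)) ≡ sum (map F L)
      mirrored [] = refl
      mirrored {x ∷ L} ((_ , x<p) ∷ h) = cong₂ _+_
        (common-neg U (≡⇒∼ (m∸n+n≡m (<⇒≤ x<p)) ▸ ≡⇒∼ (sym (+-identityʳ p)) ▸ n*p∼0 1)) (mirrored h)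
      small : All (_< p) (R ++ -R ++ replicate 7 0)
      small = All.++⁺ (All.map proj₂ R-range) (All.++⁺
        (All.map⁺ (All.map (λ (1≤x , x<p) → ∸-monoʳ-< 1≤x (<⇒≤ x<p)) R-range))
        (All.replicate⁺ 7 (≤-trans (s≤s z≤n) 157≤p)))
      occ-R : ∀ i → occ i R ≤ 7
      occ-R i = ≤-trans (m≤n+m (occ i R) (occ i U)) (≤-trans (≡⇒≤ (sym (occ-++ i U R) ⨟ occ-↭ i perm)) (mult i))
      occ-mirror : ∀ i {L} → All (λ x → 1 ≤ x × x < p) L → occ i (map (p ∸_) L) ≤ occ (p ∸ i) L
      occ-mirror i [] = z≤n
      occ-mirror i {x ∷ L} ((1≤x , x<p) ∷ h) with i ≟ p ∸ x
      ... | yes refl rewrite m∸[m∸n]≡n (<⇒≤ x<p) | δ-refl (p ∸ x) | δ-refl x =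
        s≤s (subst (λ z → occ (p ∸ x) (map (p ∸_) L) ≤ occ z L) (m∸[m∸n]≡n (<⇒≤ x<p)) (occ-mirror (p ∸ x) h))
      ... | no i≢ rewrite δ-≢ i≢ = ≤-trans (occ-mirror i h) (m≤n+m _ (δ (p ∸ i) x))
      occ-sum : ∀ i → occ i (R ++ -R ++ replicate 7 0) ≡ occ i R + (occ i -R + occ i (replicate 7 0))
      occ-sum i = occ-++ i R _ ⨟ cong (occ i R +_) (occ-++ i -R _)
      occurrences : ∀ i → occ i (R ++ -R ++ replicate 7 0) ≤ 7
      occurrences zero = ≤-trans (≡⇒≤ (occ-sum 0)) (≤-trans (≡⇒≤ (cong₂ (λ a b → a + (b + 7))
        (occ-absent (All.map (λ h → ≢-sym (<⇒≢ (proj₁ h))) R-range))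
        (occ-absent (All.map⁺ (All.map (λ h → ≢-sym (<⇒≢ (m<n⇒0<n∸m (proj₂ h)))) R-range))))) ≤-refl)
      occurrences i@(suc _) = ≤-trans (≡⇒≤ (occ-sum i)) bound
        where
        tail≡0 : occ i (replicate 7 0) ≡ 0
        tail≡0 = occ-absent {i} {replicate 7 0} (All.replicate⁺ 7 λ ())
        mirror : occ i -R + occ i (replicate 7 0) ≤ occ (p ∸ i) R
        mirror = ≤-trans (≡⇒≤ (cong (occ i -R +_) tail≡0 ⨟ +-identityʳ _)) (occ-mirror i {R} R-range)
        bound : occ i R + (occ i -R + occ i (replicate 7 0)) ≤ 7
        bound with 1 ≤? occ i R | 1 ≤? occ (p ∸ i) R
        ... | no h | _ = ≤-trans (+-mono-≤ (≡⇒≤ (occ-∉ i R h)) mirror) (occ-R (p ∸ i))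
        ... | yes h | no g = ≤-trans (+-monoʳ-≤ (occ i R) (≤-trans mirror (≡⇒≤ (occ-∉ (p ∸ i) R g))))
                               (≤-trans (≡⇒≤ (+-identityʳ _)) (occ-R i))
        ... | yes h | yes g = ⊥-elim (no-opposites U perm (occ-positive i R h) (occ-positive (p ∸ i) R g)
          (≡⇒∼ (m+[n∸m]≡n (<⇒≤ (proj₂ (All.lookup R-range (occ-positive i R h))))
                 ⨟ sym (+-identityʳ p)) ▸ n*p∼0 1))

    -- By averaging over R, whose values occur at most 7 times.
    grow : Multiplicities≤ 7 T → ∀ N N' → Grows N N' → ∀ {U R} → U ++ R ↭ T → 73 ≤ length R → N ≤ size U →
      ∃₂ λ r M → R ↭ r ∷ M × suc N' ≤ size (r ∷ U)
    grow mult N N' check {U} {R} perm long N≤ with any? (λ r → suc N' ≤? size (r ∷ U)) R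
    ... | yes some with find some
    ...   | r , r∈R , h with pick r∈R
    ...     | M , R↭rM = r , M , R↭rM , h
    grow mult N N' check {U} {R} perm long N≤ | no none = ⊥-elim (<⇒≱ (check n<N' N≤) (begin
      2 * (73 * (2 * size U ∸ N')) + 7 * size U
        ≤⟨ +-monoˡ-≤ (7 * size U) (*-monoʳ-≤ 2 (≤-trans (*-monoˡ-≤ (2 * size U ∸ N') long) (average R small))) ⟩
      2 * sum (map (common U) R) + 7 * size U
        ≤⟨ common-bound mult {U} {R} perm ⟩
      7 * (size U * size U) ∎))
      where
      open ≤-Reasoning
      small : All (λ r → size (r ∷ U) ≤ N') R
      small = All.map (λ h → ≤-pred (≰⇒> h)) (All.¬Any⇒All¬ R none)
      below : ∀ {L} → All (λ r → size (r ∷ U) ≤ N') L → 73 ≤ length L → size U ≤ N'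
      below {r ∷ _} (h ∷ _) _ = ≤-trans (≤-trans (m≤m+n (size U) 0) (size-grows r U {[]} [] [])) h
      n<N' : size U < suc N'
      n<N' = s≤s (below small long)
      -- By `size-∷`, `common U r` is 2 `size U` - `size (r ∷ U)`, hence at least 2 `size U` - N'.
      average : ∀ L → All (λ r → size (r ∷ U) ≤ N') L →
        length L * (2 * size U ∸ N') ≤ sum (map (common U) L)
      average []      []      = z≤n
      average (r ∷ L) (h ∷ hs) = +-mono-≤
        (m≤n+o⇒m∸n≤o (2 * size U) N' (≤-trans
          (≡⇒≤ (cong (size U +_) (+-identityʳ _) ⨟ sym (size-∷ r U)))
          (+-monoˡ-≤ (common U r) h)))
        (average L hs)

    -- With α ≤ 7, five averaging steps would give five terms with at least 20 sums, against 2 + 2·5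
    -- + 7 = 19. As p ≥ 157 gives |T| ≥ 78, at least 73 terms are available at each step.
    multiplicity-large : ∀ {α} → Multiplicities≤ α T → 8 ≤ α
    multiplicity-large {α} mult with 8 ≤? α
    ... | yes h = h
    ... | no ¬h = ⊥-elim contra
      where
      mult7 : Multiplicities≤ 7 T
      mult7 i = ≤-trans (mult i) (≤-pred (≰⇒> ¬h))

      Stage : ℕ → ℕ → Set
      Stage k N = ∃₂ λ U R → U ++ R ↭ T × length U ≡ k × N ≤ size U

      next : ∀ N N' {k} → Grows N N' → k ≤ 4 → Stage k N → Stage (suc k) (suc N')
      next N N' {k} check k≤4 (U , R , perm , len , N≤) = finish (grow mult7 N N' check {U} {R} perm long-R N≤)
        where
        remaining : ∀ {a k r t} → k ≤ 4 → 5 + a ≤ t → t ≤ k + r → a ≤ r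
        remaining {a} {k} {r} {t} h g eq = linear 1 (h ⊕ g ⊕ eq) (arith a k r t)
          where
          arith : ∀ a k r t → a + (4 + t + (k + r)) + 1 ≡ r + (k + (5 + a) + t)
          arith = solve-∀
        long-R : 73 ≤ length R
        long-R = remaining {73} k≤4 78≤T (≡⇒≤ (sym (↭.↭-length perm) ⨟ length-++ U ⨟ cong (_+ length R) len))
        finish : (∃₂ λ r M → R ↭ r ∷ M × suc N' ≤ size (r ∷ U)) → Stage (suc k) (suc N')
        finish (r , M , R↭rM , h) =
          r ∷ U , M , ↭-trans (↭-sym (↭.shift r U M)) (↭-trans (↭.++⁺ˡ U (↭-sym R↭rM)) perm) , cong suc len , h

      stage₅ : Stage 5 20
      stage₅ = next 14 19 grows₅ ≤-refl (next 8 13 grows₄ (m≤m+n 3 1) (next 4 7 grows₃ (m≤m+n 2 2)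
        (next 2 3 grows₂ (m≤m+n 1 3) (next 1 1 grows₁ z≤n stage₀))))
        where
        stage₀ : Stage 0 1
        stage₀ = [] , T , ↭-refl , refl , size-≥ [] {0 ∷ []} ([] ∷ []) (closes-zero [] refl ∷ [])

      contra : ⊥
      contra = finish stage₅
        where
        finish : Stage 5 20 → ⊥
        finish (U , R , perm , len , h) = <⇒≱ h
          (subst (λ k → size U ≤ 2 + 2 * k + 7) len (size-bound mzs mult7 (s≤s z≤n) U R perm))

-- Intervals of sums, and doubling

min-first : ∀ w W → ∃₂ λ z H → w ∷ W ↭ z ∷ H × All (z ≤_) H
min-first w [] = w , [] , ↭-refl , []
min-first w (x ∷ W) with min-first x W
... | z , H , perm , z≤H with w ≤? z
...   | yes w≤z = w , z ∷ H , prep w perm , w≤z ∷ All.map (≤-trans w≤z) z≤H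
...   | no w≰z  = z , w ∷ H , ↭-trans (prep w perm) (swap w z ↭-refl) , <⇒≤ (≰⇒> w≰z) ∷ z≤H

find-pair : ∀ {C : ℕ → ℕ → Set} → (∀ x y → Dec (C x y)) → ∀ W →
  AllPairs C W ⊎ ∃₂ λ x y → ∃ λ R → W ↭ x ∷ y ∷ R × ¬ C x y
find-pair C? [] = inj₁ []
find-pair {C} C? (w ∷ W) with any? (λ x → ¬? (C? w x)) W
... | yes some with find some
...   | y , y∈W , ¬c with pick y∈W
...     | R , W↭yR = inj₂ (w , y , R , prep w W↭yR , ¬c)
find-pair {C} C? (w ∷ W) | no none with find-pair C? W
...   | inj₁ pairs = inj₁ (All.map (λ {y} → decidable-stable (C? w y)) (All.¬Any⇒All¬ W none) ∷ pairs)
...   | inj₂ (x , y , R , perm , ¬c) =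
  inj₂ (x , y , w ∷ R , ↭-trans (prep w perm) (↭.shifts (w ∷ []) (x ∷ y ∷ [])) , ¬c)

intervals : ℕ → List ℕ → List ℕ
intervals M []       = []
intervals M (c ∷ cs) = applyUpTo (c +_) (suc M) ++ intervals M cs

Apart : ℕ → ℕ → ℕ → Set
Apart M c d = c + M < d ⊎ d + M < c

length-intervals : ∀ M cs → length (intervals M cs) ≡ length cs * suc M
length-intervals M []       = refl
length-intervals M (c ∷ cs) =
  length-++ (applyUpTo (c +_) (suc M)) ⨟ cong₂ _+_ (length-applyUpTo (c +_) (suc M)) (length-intervals M cs)

All-intervals : ∀ {P : ℕ → Set} M {cs} → All (λ c → ∀ i → i ≤ M → P (c + i)) cs → All P (intervals M cs)
All-intervals M []       = []
All-intervals M (h ∷ hs) = All.++⁺ (All.applyUpTo⁺₁ _ (suc M) (λ i<M → h _ (≤-pred i<M))) (All-intervals M hs)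

∈-intervals : ∀ M cs {x} → x ∈ intervals M cs → ∃₂ λ c i → c ∈ cs × i ≤ M × x ≡ c + i
∈-intervals M (c ∷ cs) x∈ with ∈-++⁻ (applyUpTo (c +_) (suc M)) x∈
... | inj₁ x∈c with ∈-applyUpTo⁻ (c +_) x∈c
...   | i , i<M , eq = c , i , here refl , ≤-pred i<M , eq
∈-intervals M (c ∷ cs) x∈ | inj₂ x∈cs with ∈-intervals M cs x∈cs
...   | d , i , d∈ , i≤M , eq = d , i , there d∈ , i≤M , eq

unique-intervals : ∀ M {cs} → AllPairs (Apart M) cs → Unique (intervals M cs)
unique-intervals M [] = []
unique-intervals M {c ∷ cs} (apart ∷ pairs) =
  Unique.++⁺ (Unique.applyUpTo⁺₁ _ (suc M) (λ i<j _ eq → <⇒≢ i<j (+-cancelˡ-≡ c _ _ eq)))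
    (unique-intervals M pairs) disjoint
  where
  disjoint : ∀ {x} → x ∈ applyUpTo (c +_) (suc M) × x ∈ intervals M cs → ⊥
  disjoint (x∈c , x∈cs) with ∈-applyUpTo⁻ (c +_) x∈c | ∈-intervals M cs x∈cs
  ... | i , s≤s i≤M , refl | d , j , d∈ , j≤M , eq with All.lookup apart d∈
  ...   | inj₁ c+M<d = <⇒≢ (<-≤-trans (≤-<-trans (+-monoʳ-≤ c i≤M) c+M<d) (m≤m+n d j)) eq
  ...   | inj₂ d+M<c = <⇒≢ (<-≤-trans (≤-<-trans (+-monoʳ-≤ d j≤M) d+M<c) (m≤m+n c i)) (sym eq)

module Closure (p : ℕ) {{_ : NonZero p}} (p-prime : Prime p) (2<p : 2 < p) where

  open Mod p
  open Residues p p-prime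
  open Sequences p p-prime

  p∼0 : p ∼ 0
  p∼0 = ≡⇒∼ (sym (+-identityʳ p)) ▸ n*p∼0 1

  p+∼ : ∀ x → p + x ∼ x
  p+∼ x = ∼-+ p∼0 refl

  -- `i` itself is a subset sum of `U`: `neg` cancels the sign in `closes`.
  Hit : List ℕ → ℕ → Set
  Hit U i = closes U (neg i) ≡ true

  Interval : List ℕ → ℕ → Set
  Interval U M = ∀ i → i ≤ M → Hit U i

  hit-cong : ∀ U {i j} → i ∼ j → Hit U i → Hit U j
  hit-cong U h = subst (_≡ true) (closes-cong U (neg-∼ h))

  hit-zero : ∀ U → Hit U 0
  hit-zero U = closes-zero U refl

  hit-keep : ∀ A U i → Hit U i → Hit (A ++ U) i
  hit-keep A U i = closes-keep A U

  hit-add : ∀ A U i {j} → sum A + i ∼ j → Hit U i → Hit (A ++ U) j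
  hit-add A U i {j} eq h = hit-cong (A ++ U) {sum A + i} {j} eq (closes-add A U (closes-cong U shifted ⨟ h))
    where
    shifted : sum A + neg (sum A + i) ∼ neg i
    shifted = ≡⇒∼ (cong (sum A +_) (neg-+ (sum A) i) ⨟ sym (+-assoc (sum A) (neg (sum A)) (neg i)))
              ▸ ∼-+ (+-neg (sum A)) refl

  -- [0, s] and its translate [w, w + s] overlap or abut. `A` is a list so that two or three large
  -- terms whose sum wraps to a small w can be absorbed as one block.
  interval-∷ : ∀ A V {s w} → Interval V s → sum A ∼ w → w ≤ suc s → Interval (A ++ V) (w + s)
  interval-∷ A V {s} {w} int A∼w w≤s i i≤ with i ≤? s
  ... | yes i≤s = hit-keep A V i (int i i≤s)
  ... | no i≰s with m≤n⇒∃[o]m+o≡n (≤-trans w≤s (≰⇒> i≰s))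
  ...   | o , refl = hit-add A V o (∼-+ A∼w refl) (int o (+-cancelˡ-≤ w o s i≤))

  unique-neg : ∀ {L} → Unique L → All (_< p) L → Unique (map (_% p) (map neg L))
  unique-neg [] [] = []
  unique-neg (x∉L ∷ uniq) (x<p ∷ L<p) =
    All.map⁺ (All.map⁺ (All.zipWith (λ (x≢y , y<p) eq → x≢y (∼⇒≡ x<p y<p (neg-injective eq))) (x∉L , L<p)))
    ∷ unique-neg uniq L<p

  size-intervals : ∀ U M cs → All (λ c → c + M < p) cs → AllPairs (Apart M) cs →
    All (λ c → ∀ i → i ≤ M → Hit U (c + i)) cs → length cs * suc M ≤ size U
  size-intervals U M cs cs<p apart hits =
    subst (_≤ size U) (length-map neg (intervals M cs) ⨟ length-intervals M cs)
      (size-≥ U (unique-neg (unique-intervals M apart)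
                  (All-intervals M (All.map (λ c<p i i≤M → ≤-<-trans (+-monoʳ-≤ _ i≤M) c<p) cs<p)))
                (All.map⁺ (All-intervals M hits)))

  -- For nonzero residues over g and c not divisible by p, this is p times the norm with respect to
  -- the generator c⁻¹ g.
  scaled : ℕ → List ℕ → ℕ
  scaled c L = sum (map (λ x → c * x % p) L)

  scaled-≤ : ∀ c L → scaled c L ≤ c * sum L
  scaled-≤ c []      = z≤n
  scaled-≤ c (x ∷ L) = ≤-trans (+-mono-≤ (m%n≤m (c * x) p) (scaled-≤ c L)) (≡⇒≥ (*-distribˡ-+ c x (sum L)))

  scaled-↭ : ∀ c {L M} → L ↭ M → scaled c L ≡ scaled c M
  scaled-↭ c perm = sum-↭ (↭.map⁺ _ perm)

  Done : List ℕ → Set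
  Done T = ∃ λ c → 1 ≤ c × c < p × scaled c T ≤ 2 * p

  done₁ : ∀ T → sum T ≤ 2 * p → Done T
  done₁ T h = 1 , ≤-refl , <-trans (n<1+n 1) 2<p ,
    ≤-trans (scaled-≤ 1 T) (≤-trans (≡⇒≤ (*-identityˡ (sum T))) h)

  module _ {T : List ℕ} (mzs : MinimalZeroSum T) where

    open MinimalZeroSum mzs

    hit-free : ∀ {w r} W U R {i} → w ∷ W ++ U ++ r ∷ R ↭ T → Hit U i → ¬ sum (w ∷ W) + i ∼ 0
    hit-free {w} W U R {i} perm h z = contradiction
      (sym h ⨟ closes-cong U (sym (∼neg {sum (w ∷ W)} z)) ⨟ free mzs W U R perm) λ ()

    -- Sums do not wrap around: they would hit zero on the way.
    no-wrap : ∀ {w r} W U R {v M} → w ∷ W ++ U ++ r ∷ R ↭ T → sum (w ∷ W) ∼ v → v < p →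
      Interval U M → v + M < p
    no-wrap {w} W U R {v} {M} perm W∼v v<p int with v + M <? p
    ... | yes h = h
    ... | no ¬h = ⊥-elim (hit-free W U R {p ∸ v} perm
      (int (p ∸ v) (m≤n+o⇒m∸n≤o p v (≮⇒≥ ¬h)))
      (∼-+ W∼v refl ▸ ≡⇒∼ (m+[n∸m]≡n (<⇒≤ v<p)) ▸ p∼0))

    no-wrap₁ : ∀ {w r} U R {M} → w ∷ U ++ r ∷ R ↭ T → Interval U M → w + M < p
    no-wrap₁ {w} U R perm = no-wrap [] U R perm (≡⇒∼ (+-identityʳ w)) (proj₂ (in-range mzs perm))

    sum-T : ∀ V W → V ++ W ↭ T → sum T ≡ sum V + sum W
    sum-T V W perm = sym (sum-↭ perm) ⨟ sum-++ V W

    -- Greedy choice of V: a term up to `sum V` + 1 prolongs the interval, and absence of wrapping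
    -- keeps the sum below p while a term remains outside. If at most one term is left over, `sum T`
    -- is below 2p.
    closure : ∀ n V W → length W ≤ n → V ++ W ↭ T → Interval V (sum V) → sum V < p →
      sum T ≤ 2 * p ⊎ ∃₂ λ V w → ∃ λ W → V ++ w ∷ W ↭ T × Interval V (sum V) × sum V < p ×
        All (2 + sum V ≤_) (w ∷ W)
    closure n V [] len perm int V<p = inj₁ (≤-trans
      (≡⇒≤ (sum-T V [] perm ⨟ +-identityʳ (sum V))) (≤-trans (<⇒≤ V<p) (m≤m+n p _)))
    closure zero V (w ∷ W) () perm int V<p
    closure (suc n) V (w ∷ W) len perm int V<p with any? (λ x → x ≤? suc (sum V)) (w ∷ W)
    ... | no none = inj₂ (V , w , W , perm , int , V<p , All.map ≰⇒> (All.¬Any⇒All¬ (w ∷ W) none))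
    ... | yes some with find some
    ...   | x , x∈W , x≤ with pick x∈W
    ...     | [] , wW↭x = inj₁ (≤-trans (≡⇒≤ (sum-T V (w ∷ W) perm ⨟ cong (sum V +_) (sum-↭ wW↭x ⨟ +-identityʳ x)))
                  (≤-trans (+-mono-≤ (<⇒≤ V<p) (<⇒≤ x<p)) (≡⇒≤ (cong (p +_) (sym (+-identityʳ p))))))
      where
      x<p : x < p
      x<p = proj₂ (in-range mzs (↭-trans (↭-sym (↭.shift x V [])) (↭-trans (↭.++⁺ˡ V (↭-sym wW↭x)) perm)))
    ...     | r ∷ M , wW↭x = closure n (x ∷ V) (r ∷ M) (≤-pred (≤-trans (≡⇒≥ (↭.↭-length wW↭x)) len)) perm'
                  (interval-∷ (x ∷ []) V int (≡⇒∼ (+-identityʳ x)) x≤) (no-wrap₁ V M perm' int)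
      where
      perm' : x ∷ V ++ r ∷ M ↭ T
      perm' = ↭-trans (↭-sym (↭.shift x V (r ∷ M))) (↭-trans (↭.++⁺ˡ V (↭-sym wW↭x)) perm)

    -- What `interval-∷` needs to absorb the pair as one block after a single wrap.
    Compatible : ℕ → ℕ → ℕ → Set
    Compatible s x y = p < x + y × x + y ≤ p + suc s

    compatible? : ∀ s x y → Dec (Compatible s x y)
    compatible? s x y = (p <? x + y) ×-dec (x + y ≤? p + suc s)

    -- The elements exceed p/2 except possibly the least one, z, so doubling turns
    -- each pair into its small sum.  A pair left over at the end is impossible.
    pairing : ∀ {s z} H P {M} → P ++ z ∷ H ↭ T → Interval P M → sum P ∼ M → M < p → scaled 2 P ≤ 2 * M →
      s ≤ M → AllPairs (Compatible s) (z ∷ H) → All (z ≤_) H → scaled 2 T ≤ 2 * p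
    -- Only z is left: M + z ≡ 0 with 0 < M + z < 2p, so M + z = p.
    pairing {s} {z} [] P {M} perm int P∼M M<p dbl s≤M pairs z≤H = begin
      scaled 2 T                      ≡⟨ scaled-↭ 2 perm ⟨
      scaled 2 (P ++ z ∷ [])          ≡⟨ cong sum (map-++ _ P (z ∷ [])) ⨟ sum-++ (map _ P) _ ⟩
      scaled 2 P + (2 * z % p + 0)    ≤⟨ +-mono-≤ dbl (≤-trans (≡⇒≤ (+-identityʳ _)) (m%n≤m (2 * z) p)) ⟩
      2 * M + 2 * z                   ≡⟨ *-distribˡ-+ 2 M z ⟨
      2 * (M + z)                     ≡⟨ cong (2 *_) total≡p ⟩
      2 * p                           ∎
      where
      open ≤-Reasoning
      z-range : 1 ≤ z × z < p
      z-range = in-range mzs (↭-trans (↭-sym (↭.shift z P [])) perm)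
      M+z∼0 : M + z ∼ 0
      M+z∼0 = ∼-+ (sym P∼M) refl ▸ ≡⇒∼ (cong (sum P +_) (sym (+-identityʳ z)) ⨟ sym (sum-T P (z ∷ []) perm)) ▸ total
      total≡p : M + z ≡ p
      total≡p with m≤n⇒∃[o]m+o≡n (p≤ M+z∼0 (≤-trans (proj₁ z-range) (m≤n+m z M)))
      ... | o , eq = sym eq ⨟ cong (p +_) (∼⇒≡ (+-cancelˡ-< p o p (subst (_< p + p) (sym eq) (+-mono-< M<p (proj₂ z-range))))
                      (<-trans (s≤s z≤n) 2<p) (sym (p+∼ o) ▸ ≡⇒∼ eq ▸ M+z∼0)) ⨟ +-identityʳ p
    -- A last pair has residue w = z + h - p ≥ 1 with w + M ≡ 0, hence w + M ≥ p; but w < h and h +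
    -- M < p.
    pairing {s} {z} (h ∷ []) P {M} perm int P∼M M<p dbl s≤M ((( p<zh , zh≤) ∷ []) ∷ _) z≤H
      with m≤n⇒∃[o]m+o≡n (<⇒≤ p<zh)
    ... | w , eq = ⊥-elim (absurd 1
            (p≤ w+M∼0 (≤-trans (+-cancelˡ-≤ p 1 w (≤-trans (≡⇒≤ (+-comm p 1)) (≤-trans p<zh (≡⇒≥ eq)))) (m≤m+n w M))
              ⊕ ≡⇒≤ eq ⊕ no-wrap₁ P [] (↭-trans (rearrange 3 (λ h P z → h ∪ P ∪ z ≐ P ∪ z ∪ h) ↭-refl (h ◂ ∅) P (z ◂ ∅)) perm) int
              ⊕ proj₂ (in-range mzs (↭-trans (↭-sym (↭.shift z P (h ∷ []))) perm)))
            (arith p w M z h))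
      where
      arith : ∀ p w M z h → p + (p + w) + suc (h + M) + suc z ≡ suc (w + M + (z + h) + p + p + 1)
      arith = solve-∀
      eq' : ∀ P z h → P + (z + (h + 0)) ≡ z + h + P
      eq' = solve-∀
      w+M∼0 : w + M ∼ 0
      w+M∼0 = ∼-+ (sym (p+∼ w) ▸ ≡⇒∼ eq) (sym P∼M) ▸ ≡⇒∼ (sym (eq' (sum P) z h) ⨟ sym (sum-T P (z ∷ h ∷ []) perm)) ▸ total
    -- z is kept to the end. For x = h and x = k, z ≤ x and p < z + x give 2x ≥ p, so doubling saves
    -- p on each, and the pair contributes at most 2w to `scaled 2 T`.
    pairing {s} {z} (h ∷ k ∷ H) P {M} perm int P∼M M<p dbl s≤M
      ((( p<zh , _) ∷ (p<zk , _) ∷ zs) ∷ ((p<hk , hk≤) ∷ _) ∷ _ ∷ pairs) (z≤h ∷ z≤k ∷ z≤H)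
      with m≤n⇒∃[o]m+o≡n (<⇒≤ p<hk)
    ... | w , eq = pairing {s} {z} H (h ∷ k ∷ P) {w + M}
        (↭-trans (rearrange 5 (λ h k P z H → (h ∪ k ∪ P) ∪ z ∪ H ≐ P ∪ z ∪ h ∪ k ∪ H) ↭-refl (h ◂ ∅) (k ◂ ∅) P (z ◂ ∅) H) perm)
        (interval-∷ (h ∷ k ∷ []) P int hk∼w w≤)
        (≡⇒∼ (sum3 h k (sum P)) ▸ ∼-+ hk∼w P∼M)
        (no-wrap (k ∷ []) P H perm' hk∼w (+-cancelˡ-< p w p (subst (_< p + p) (sym eq) (+-mono-< (rng perm') (rng perm'')))) int)
        (linear 0 (half p<zh z≤h ⊕ half p<zk z≤k ⊕ dbl ⊕ 2 ⊗ ≡⇒≤ (sym eq))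
          (arith (2 * h % p) (2 * k % p) (scaled 2 P) w M h k p))
        (≤-trans s≤M (m≤n+m M w)) (zs ∷ pairs) z≤H
      where
      perm' : h ∷ k ∷ P ++ z ∷ H ↭ T
      perm' = ↭-trans (rearrange 5 (λ h k P z H → h ∪ k ∪ P ∪ z ∪ H ≐ P ∪ z ∪ h ∪ k ∪ H) ↭-refl (h ◂ ∅) (k ◂ ∅) P (z ◂ ∅) H) perm
      perm'' : k ∷ h ∷ P ++ z ∷ H ↭ T
      perm'' = ↭-trans (swap k h ↭-refl) perm'
      rng : ∀ {x L} → x ∷ L ↭ T → x < p
      rng = proj₂ ∘ in-range mzs
      hk∼w : sum (h ∷ k ∷ []) ∼ w
      hk∼w = ≡⇒∼ (cong (h +_) (+-identityʳ k) ⨟ sym eq) ▸ p+∼ w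
      w≤ : w ≤ suc M
      w≤ = ≤-trans (+-cancelˡ-≤ p w (suc s) (≤-trans (≡⇒≤ eq) hk≤)) (s≤s s≤M)
      sum3 : ∀ h k P → h + (k + P) ≡ (h + (k + 0)) + P
      sum3 = solve-∀
      half : ∀ {x} → p < z + x → z ≤ x → 2 * x % p + p ≤ 2 * x
      half {x} p<zx z≤x with m≤n⇒∃[o]m+o≡n (≤-trans (<⇒≤ p<zx) (+-monoˡ-≤ x z≤x))
      ... | o , e = subst (λ y → y % p + p ≤ y) (e ⨟ cong (x +_) (sym (+-identityʳ x)))
        (≤-trans (+-monoˡ-≤ p (≤-trans (≡⇒≤ (p+∼ o)) (m%n≤m o p))) (≡⇒≤ (+-comm o p)))
      arith : ∀ a b d w M h k p → a + (b + d) + (2 * h + 2 * k + 2 * M + 2 * (p + w)) + 0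
                                ≡ 2 * (w + M) + (a + p + (b + p) + d + 2 * (h + k))
      arith = solve-∀

    Violation : Set
    Violation = ∃₂ λ V x → ∃₂ λ y r → ∃ λ R → V ++ x ∷ y ∷ r ∷ R ↭ T × Interval V (sum V) ×
      All (2 + sum V ≤_) (x ∷ y ∷ r ∷ R) × 3 * suc (sum V) ≤ size (x ∷ y ∷ V)

    -- The three intervals start at 0, x and the residue v of x + y. If x + y wraps, incompatibility
    -- gives v ≥ s + 2 and y + s < p gives v + s < x; otherwise v = x + y > x + s. With no third
    -- term outside V, `sum T` is below 2p.
    violation : ∀ V x y R → V ++ x ∷ y ∷ R ↭ T → Interval V (sum V) → sum V < p →
      All (2 + sum V ≤_) (x ∷ y ∷ R) → ¬ Compatible (sum V) x y → Done T ⊎ Violation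
    violation V x y [] perm int V<p large incompatible = inj₁ (done₁ T (begin
      sum T                    ≡⟨ sum-T V (x ∷ y ∷ []) perm ⟩
      sum V + (x + (y + 0))    ≡⟨ arith (sum V) x y ⟩
      (x + sum V) + y          ≤⟨ +-mono-≤ (<⇒≤ (no-wrap₁ V [] perm' int)) (<⇒≤ y<p) ⟩
      p + p                    ≡⟨ cong (p +_) (+-identityʳ p) ⟨
      2 * p                    ∎))
      where
      open ≤-Reasoning
      arith : ∀ s x y → s + (x + (y + 0)) ≡ (x + s) + y
      arith = solve-∀
      perm' : x ∷ V ++ y ∷ [] ↭ T
      perm' = ↭-trans (↭-sym (↭.shift x V (y ∷ []))) perm
      y<p : y < p
      y<p = proj₂ (in-range mzs (↭-trans (↭-sym (↭.shift y (x ∷ V) [])) perm'))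
    violation V x y (r ∷ R) perm int V<p large@(x≥ ∷ y≥ ∷ _) incompatible =
      inj₂ (V , x , y , r , R , perm , int , large , three)
      where
      s : ℕ
      s = sum V
      perm-xy : x ∷ y ∷ V ++ r ∷ R ↭ T
      perm-xy = ↭-trans (rearrange 4 (λ x y V R → x ∪ y ∪ V ∪ R ≐ V ∪ x ∪ y ∪ R) ↭-refl (x ◂ ∅) (y ◂ ∅) V (r ∷ R)) perm
      perm-x : x ∷ V ++ y ∷ r ∷ R ↭ T
      perm-x = ↭-trans (↭-sym (↭.shift x V (y ∷ r ∷ R))) perm
      perm-y : y ∷ V ++ x ∷ r ∷ R ↭ T
      perm-y = ↭-trans (rearrange 4 (λ x y V R → y ∪ V ∪ x ∪ R ≐ V ∪ x ∪ y ∪ R) ↭-refl (x ◂ ∅) (y ◂ ∅) V (r ∷ R)) perm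
      xy∼ : sum (x ∷ y ∷ []) ∼ x + y
      xy∼ = ≡⇒∼ (cong (x +_) (+-identityʳ y))
      x+s<p : x + s < p
      x+s<p = no-wrap₁ V (r ∷ R) perm-x int
      y+s<p : y + s < p
      y+s<p = no-wrap₁ V (r ∷ R) perm-y int

      conclude : ∀ v → x + y ∼ v → v < p → 2 + s ≤ v → Apart s x v → 3 * suc s ≤ size (x ∷ y ∷ V)
      conclude v xy∼v v<p v≥ apart = size-intervals (x ∷ y ∷ V) s (0 ∷ x ∷ v ∷ [])
        (V<p ∷ x+s<p ∷ no-wrap (y ∷ []) V R perm-xy (xy∼ ▸ xy∼v) v<p int ∷ [])
        ((inj₁ (≤-trans (n≤1+n _) x≥) ∷ inj₁ (≤-trans (n≤1+n _) v≥) ∷ []) ∷ (apart ∷ []) ∷ [] ∷ [])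
        ((λ i i≤s → hit-keep (x ∷ y ∷ []) V i (int i i≤s))
         ∷ (λ i i≤s → hit-add (x ∷ []) (y ∷ V) i (∼-+ (≡⇒∼ (+-identityʳ x)) refl) (hit-keep (y ∷ []) V i (int i i≤s)))
         ∷ (λ i i≤s → hit-add (x ∷ y ∷ []) V i (∼-+ (xy∼ ▸ xy∼v) refl) (int i i≤s)) ∷ [])

      three : 3 * suc s ≤ size (x ∷ y ∷ V)
      three with <-cmp (x + y) p
      ... | tri< xy<p _ _ = conclude (x + y) refl xy<p (≤-trans x≥ (m≤m+n x y))
              (inj₁ (+-monoʳ-< x (≤-trans (n≤1+n _) y≥)))
      ... | tri≈ _ xy≡p _ = ⊥-elim (hit-free (y ∷ []) V R {0} perm-xy (hit-zero V)
              (≡⇒∼ (+-identityʳ _) ▸ xy∼ ▸ ≡⇒∼ xy≡p ▸ p∼0))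
      ... | tri> _ _ p<xy with m≤n⇒∃[o]m+o≡n (<⇒≤ p<xy)
      ...   | v , eq = conclude v (≡⇒∼ (sym eq) ▸ p+∼ v)
              (+-cancelˡ-< p v p (subst (_< p + p) (sym eq) (+-mono-< (≤-<-trans (m≤m+n x s) x+s<p) (≤-<-trans (m≤m+n y s) y+s<p))))
              (+-cancelˡ-≤ p _ v (≤-trans (≡⇒≤ (+-suc p (suc s))) (≤-trans (≰⇒> λ h → incompatible (p<xy , h)) (≡⇒≥ eq))))
              (inj₂ (linear 0 (≡⇒≤ eq ⊕ y+s<p) (arith v s x y p)))
        where
        arith : ∀ v s x y p → suc (v + s) + (x + y + p) + 0 ≡ x + (p + v + suc (y + s))
        arith = solve-∀

    done-or-violation : Done T ⊎ Violation
    done-or-violation with closure (length T) [] T ≤-refl ↭-refl (λ i i≤0 → hit-cong [] (≡⇒∼ (sym (n≤0⇒n≡0 i≤0))) (hit-zero [])) (<-trans (s≤s z≤n) 2<p)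
    ... | inj₁ small = inj₁ (done₁ T small)
    ... | inj₂ (V , w , W , perm , int , V<p , large) with min-first w W
    ...   | z , H , wW↭ , z≤H with find-pair (compatible? (sum V)) (z ∷ H)
    ...     | inj₁ pairs = inj₁ (2 , s≤s z≤n , 2<p ,
                pairing H V (↭-trans (↭.++⁺ˡ V (↭-sym wW↭)) perm) int refl V<p (scaled-≤ 2 V) ≤-refl pairs z≤H)
    ...     | inj₂ (x , y , R , zH↭ , bad) =
                violation V x y R (↭-trans (↭.++⁺ˡ V (↭-sym (↭-trans wW↭ zH↭))) perm) int V<p
                  (↭.All-resp-↭ (↭-trans wW↭ zH↭) large) bad

-- Locating values, and change of generator

take-out : ∀ {a : ℕ} {V W Q} → V ++ W ↭ a ∷ Q → All (_≢ a) W → ∃ λ V' → V ↭ a ∷ V' × V' ++ W ↭ Q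
take-out {a} {V} {W} perm W≢a with ∈-++⁻ V (↭.∈-resp-↭ (↭-sym perm) (here refl))
... | inj₂ a∈W = contradiction refl (All.lookup W≢a a∈W)
... | inj₁ a∈V with pick a∈V
...   | V' , V↭ = V' , V↭ , ↭.drop-∷ (↭-trans (↭.++⁺ʳ W (↭-sym V↭)) perm)

-- For use with `W` the terms outside V, all large: every copy of a small value must then lie in
-- `V`.
take-all : ∀ n {a : ℕ} {V W Q} → V ++ W ↭ replicate n a ++ Q → All (_≢ a) W →
  ∃ λ V' → V ↭ replicate n a ++ V' × V' ++ W ↭ Q
take-all zero    {V = V} perm W≢a = V , ↭-refl , perm
take-all (suc n) perm W≢a with take-out perm W≢a
... | V₁ , V↭ , perm₁ with take-all n perm₁ W≢a
...   | V₂ , V₁↭ , perm₂ = V₂ , ↭-trans V↭ (prep _ V₁↭) , perm₂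

cancel-++ : ∀ (A : List ℕ) {B C} → A ++ B ↭ A ++ C → B ↭ C
cancel-++ []      perm = perm
cancel-++ (a ∷ A) perm = cancel-++ A (↭.drop-∷ perm)

split-off : ∀ a L → ∃ λ Q → L ↭ replicate (occ a L) a ++ Q × All (_≢ a) Q
split-off a [] = [] , ↭-refl , []
split-off a (x ∷ L) with split-off a L | a ≟ x
... | Q , perm , Q≢a | yes refl rewrite δ-refl a = Q , prep a perm , Q≢a
... | Q , perm , Q≢a | no a≢x rewrite δ-≢ a≢x =
  x ∷ Q , ↭-trans (prep x perm) (↭-sym (↭.shift x (replicate (occ a L) a) Q)) , ≢-sym a≢x ∷ Q≢a

argmax : ∀ (F : ℕ → ℕ) x L → ∃ λ a → a ∈ x ∷ L × All (λ i → F i ≤ F a) (x ∷ L)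
argmax F x [] = x , here refl , ≤-refl ∷ []
argmax F x (y ∷ L) with argmax F y L
... | a , a∈ , max with F x ≤? F a
...   | yes h = a , there a∈ , h ∷ max
...   | no ¬h = x , here refl , ≤-refl ∷ All.map (λ g → ≤-trans g (<⇒≤ (≰⇒> ¬h))) max

map-split : ∀ {a} {X : Set a} (h : X → ℕ) A {B} L → A ++ B ≡ map h L →
  ∃₂ λ M N → L ≡ M ++ N × A ≡ map h M × B ≡ map h N
map-split h []      L       eq = [] , L , refl , refl , eq
map-split h (a ∷ A) (x ∷ L) eq with ∷-injective eq
... | refl , eq' with map-split h A L eq'
...   | M , N , refl , refl , eq'' = x ∷ M , N , refl , refl , eq''

sum-≥ : ∀ k {L} → All (k ≤_) L → k * length L ≤ sum L
sum-≥ k [] = ≡⇒≤ (*-zeroʳ k)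
sum-≥ k {x ∷ L} (h ∷ hs) = ≤-trans (≡⇒≤ (*-suc k (length L))) (+-mono-≤ h (sum-≥ k hs))

module Rescaling (p : ℕ) {{_ : NonZero p}} (p-prime : Prime p) (2<p : 2 < p) where

  open Mod p
  open Residues p p-prime
  open Sequences p p-prime
  open Multiplicity p p-prime
  open Closure p p-prime 2<p

  rescale : ℕ → List ℕ → List ℕ
  rescale c = map (λ x → c * x % p)

  *≁0 : ∀ {c x} → ¬ c ∼ 0 → ¬ x ∼ 0 → ¬ c * x ∼ 0
  *≁0 {c} {x} c≁0 x≁0 h = x≁0 (∼-cancel-* c≁0 (≡⇒∼ (*-comm x c) ▸ h))

  module _ {c T} (c≁0 : ¬ c ∼ 0) (mzs : MinimalZeroSum T) where

    open MinimalZeroSum mzs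

    sum-rescale : ∀ L → sum (rescale c L) ∼ c * sum L
    sum-rescale []      = ≡⇒∼ (sym (*-zeroʳ c))
    sum-rescale (x ∷ L) = ∼-+ (%-∼ (c * x)) (sum-rescale L) ▸ ≡⇒∼ (sym (*-distribˡ-+ c x (sum L)))

    rescale-mzs : MinimalZeroSum (rescale c T)
    rescale-mzs = record
      { range   = All.map⁺ (All.map (λ (1≤x , x<p) →
                    n≢0⇒n>0 (λ z → *≁0 c≁0 (≁0 1≤x x<p) (z ⨟ sym 0%p)) , m%n<n _ p) range)
      ; total   = sum-rescale T ▸ ∼-*ˡ c total ▸ ≡⇒∼ (*-zeroʳ c)
      ; minimal = minimal'
      ; long    = subst (λ l → p ≤ 1 + 2 * l) (sym (length-map _ T)) long
      }
      where
      minimal' : ∀ {u U r R} → u ∷ U ++ r ∷ R ↭ rescale c T → ¬ sum (u ∷ U) ∼ 0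
      minimal' {u} {U} {r} {R} perm z with ↭.↭-map-inv (λ x → c * x % p) (↭-sym perm)
      ... | L , eq , T↭L with map-split _ (u ∷ U) L eq
      ...   | m ∷ M , n ∷ N , refl , refl , _ = minimal {m} {M} {n} {N} (↭-sym T↭L)
        (∼-cancel-* c≁0 (≡⇒∼ (*-comm (sum (m ∷ M)) c) ▸ sym (sum-rescale (m ∷ M)) ▸ z))

    -- c is invertible, so all occurrences of i come from the single residue d i.
    rescale-multiplicities : ∀ {α} → Multiplicities≤ α T → Multiplicities≤ α (rescale c T)
    rescale-multiplicities mult i with inverse c≁0
    ... | d , dc∼1 = ≤-trans (go (All.map proj₂ range)) (mult (d * i % p))
      where
      go : ∀ {L} → All (_< p) L → occ i (rescale c L) ≤ occ (d * i % p) L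
      go [] = z≤n
      go {x ∷ L} (x<p ∷ L<p) with i ≟ c * x % p
      ... | no ne rewrite δ-≢ ne = ≤-trans (go L<p) (m≤n+m _ (δ (d * i % p) x))
      ... | yes eq = +-mono-≤ (≡⇒≤ (cong₂ δ eq refl ⨟ δ-refl (c * x % p)
                       ⨟ sym (cong₂ δ back refl ⨟ δ-refl x))) (go L<p)
        where
        back : d * i % p ≡ x
        back = ∼⇒≡ (m%n<n (d * i) p) x<p (%-∼ (d * i) ▸ ∼-*ˡ d (≡⇒∼ eq ▸ %-∼ (c * x))
          ▸ ≡⇒∼ (sym (*-assoc d c x)) ▸ ∼-* dc∼1 refl ▸ ≡⇒∼ (*-identityˡ x))

    rescale-done : Done (rescale c T) → Done T
    rescale-done (d , 1≤d , d<p , h) = d * c % p ,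
      n≢0⇒n>0 (λ z → *≁0 (≁0 1≤d d<p) c≁0 (z ⨟ sym 0%p)) , m%n<n _ p ,
      ≤-trans (≡⇒≤ (same T)) h
      where
      same : ∀ L → scaled (d * c % p) L ≡ scaled d (rescale c L)
      same []      = refl
      same (x ∷ L) = cong₂ _+_ (∼-* (%-∼ (d * c)) refl ▸ ≡⇒∼ (*-assoc d c x) ▸ ∼-*ˡ d (sym (%-∼ (c * x)))) (same L)

  rescale-replicate : ∀ c n x L → rescale c (replicate n x ++ L) ≡ replicate n (c * x % p) ++ rescale c L
  rescale-replicate c n x L = map-++ _ (replicate n x) L ⨟ cong (_++ rescale c L) (map-replicate _ n x)

-- A unit beside many twos or threes

module UnitPresent (p : ℕ) {{_ : NonZero p}} (p-prime : Prime p) (157≤p : 157 ≤ p) where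

  2<p : 2 < p
  2<p = ≤-trans (m≤m+n 3 154) 157≤p

  open Mod p
  open Residues p p-prime
  open Sequences p p-prime
  open Multiplicity p p-prime
  open Closure p p-prime 2<p
  open Rescaling p p-prime 2<p

  module _ {T α} (mzs : MinimalZeroSum T) (mult : Multiplicities≤ α T) (8≤α : 8 ≤ α) where

    open MinimalZeroSum mzs

    bound : ∀ U R → U ++ R ↭ T → size U ≤ 2 + 2 * length U + α
    bound = size-bound mzs mult (≤-trans (m≤m+n 1 7) 8≤α)

    private
      All≥⇒≢ : ∀ {a b L} → All (b ≤_) L → a < b → All (_≢ a) L
      All≥⇒≢ h a<b = All.map (λ b≤x eq → <⇒≱ a<b (subst (_ ≤_) eq b≤x)) h

      positive : ∀ {V W} → V ++ W ↭ T → All (1 ≤_) V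
      positive {V} perm = All.++⁻ˡ V (↭.All-resp-↭ (↭-sym perm) (All.map proj₁ range))

      bound-xy : ∀ V x y R → V ++ x ∷ y ∷ R ↭ T → size (x ∷ y ∷ V) ≤ 2 + 2 * (2 + length V) + α
      bound-xy V x y R perm = bound (x ∷ y ∷ V) R
        (↭-trans (rearrange 4 (λ x y V R → (x ∪ y ∪ V) ∪ R ≐ V ∪ x ∪ y ∪ R) ↭-refl (x ◂ ∅) (y ◂ ∅) V R) perm)

    -- Terms outside V exceed `sum V` + 1, so V contains 1, then `y`, then all α copies of `a`.
    -- Hence `sum V` ≥ |V| + α, and three intervals need 3(|V| + α + 1) sums where 2|V| + α + 6 are
    -- allowed.
    done-with-unit : ∀ {a y Q Q'} → 2 ≤ a → a ≤ 3 → 1 ≤ y → y ≤ 2 →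
      T ↭ 1 ∷ y ∷ Q → T ↭ replicate α a ++ Q' → Done T
    done-with-unit {a} {y} 2≤a a≤3 1≤y y≤2 T↭1y T↭a with done-or-violation mzs
    ... | inj₁ done = done
    ... | inj₂ (V , x , x' , r , R , perm , int , large , three)
      with take-out (↭-trans perm T↭1y) (All≥⇒≢ large (s≤s (s≤s z≤n)))
    ...   | V₁ , V↭1 , perm₁
      with take-out perm₁ (All≥⇒≢ large (s≤s (≤-trans y≤2
             (≤-trans (s≤s (m≤m+n 1 (sum V₁))) (≡⇒≥ (cong suc (sum-↭ V↭1)))))))
    ...     | V₂ , V₁↭y , _
      with take-all α (↭-trans perm T↭a) (All≥⇒≢ large (s≤s (≤-trans a≤3 (s≤s (≤-trans
             (+-mono-≤ (≤-refl {1}) (≤-trans 1≤y (m≤m+n y (sum V₂))))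
             (≡⇒≥ (sum-↭ V↭1 ⨟ cong (1 +_) (sum-↭ V₁↭y))))))))
    ...       | V₃ , V↭a , perm₃ = absurd (2 * α + length V₃ + 4)
      (three ⊕ bound-xy V x x' (r ∷ R) perm ⊕ 3 ⊗ ≡⇒≥ (sum-↭ V↭a ⨟ sum-++ (replicate α a) V₃ ⨟ cong (_+ sum V₃) (sum-replicate α a))
        ⊕ 2 ⊗ ≡⇒≤ (↭.↭-length V↭a ⨟ length-++ (replicate α a) ⨟ cong (_+ length V₃) (length-replicate α))
        ⊕ 3 ⊗ *-monoʳ-≤ α 2≤a ⊕ 3 ⊗ sum-≥ 1 (All.++⁻ʳ (replicate α a) (↭.All-resp-↭ V↭a (positive {V} perm))) ⊕ 8≤α)
      (arith (sum V) (size (x ∷ x' ∷ V)) (length V) α a (sum V₃) (length V₃))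
      where
      arith : ∀ s n l α a t m → 3 * suc s + n + 3 * (α * a + t) + 2 * l + 3 * (α * 2) + 3 * (1 * m) + 8
        ≡ suc (n + (2 + 2 * (2 + l) + α) + 3 * s + 2 * (α + m) + 3 * (α * a) + 3 * t + α + (2 * α + m + 4))
      arith = solve-∀

-- Twos, threes and larger terms

module TwosAndThrees (p : ℕ) {{_ : NonZero p}} (p-prime : Prime p) (157≤p : 157 ≤ p) where

  open UnitPresent p p-prime 157≤p

  open Mod p
  open Residues p p-prime
  open Sequences p p-prime
  open Multiplicity p p-prime
  open Closure p p-prime 2<p
  open Rescaling p p-prime 2<p

  -- The sums of a sequence of twos and threes fill [0, s] except for 1 and s − 1.
  Gapped : List ℕ → ℕ → Set
  Gapped U s = ∀ i → i ≤ s → i ≢ 1 → suc i ≢ s → Hit U i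

  -- The sums are 0, 2, 3, 4, 5, 7. With s = 7 both 2 and 3 satisfy z + 3 ≤ s, so every further two
  -- and three can be absorbed.
  gapped-base : Gapped (2 ∷ 2 ∷ 3 ∷ []) 7
  gapped-base 0 _ _ _ = hit-zero (2 ∷ 2 ∷ 3 ∷ [])
  gapped-base 1 _ h _ = contradiction refl h
  gapped-base 2 _ _ _ = hit-add (2 ∷ []) (2 ∷ 3 ∷ []) 0 refl (hit-zero (2 ∷ 3 ∷ []))
  gapped-base 3 _ _ _ = hit-keep (2 ∷ 2 ∷ []) (3 ∷ []) 3 (hit-add (3 ∷ []) [] 0 refl (hit-zero []))
  gapped-base 4 _ _ _ = hit-add (2 ∷ 2 ∷ []) (3 ∷ []) 0 refl (hit-zero (3 ∷ []))
  gapped-base 5 _ _ _ = hit-keep (2 ∷ []) (2 ∷ 3 ∷ []) 5 (hit-add (2 ∷ 3 ∷ []) [] 0 refl (hit-zero []))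
  gapped-base 6 _ _ h = contradiction refl h
  gapped-base 7 _ _ _ = hit-add (2 ∷ 2 ∷ 3 ∷ []) [] 0 refl (hit-zero [])
  gapped-base (suc (suc (suc (suc (suc (suc (suc (suc i)))))))) (s≤s (s≤s (s≤s (s≤s (s≤s (s≤s (s≤s ()))))))) _ _

  -- Positions up to s - 2 are left to `V`, later ones are reached through z. As z + 3 ≤ s, the
  -- lower gap z + 1 of the translate is at most s - 2, where `V` covers it; so only the top gap
  -- moves.
  gapped-∷ : ∀ {V s z} → Gapped V s → 2 ≤ z → 3 + z ≤ s → Gapped (z ∷ V) (z + s)
  gapped-∷ {V} {s} {z} gap 2≤z z+3≤s i i≤ i≢1 i≢ with suc i <? s
  ... | yes i<s = hit-keep (z ∷ []) V i (gap i (<⇒≤ (<⇒≤ i<s)) i≢1 (<⇒≢ i<s))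
  ... | no i≮s with m≤n⇒∃[o]m+o≡n (≤-pred (≤-trans (≤-trans (m≤n+m (suc z) 2) z+3≤s) (≮⇒≥ i≮s)))
  ...   | o , refl = hit-add (z ∷ []) V o (∼-+ (≡⇒∼ (+-identityʳ z)) refl)
          (gap o (+-cancelˡ-≤ z o s i≤)
            (λ o≡1 → i≮s (subst (λ o → suc (z + o) < s) (sym o≡1) (≤-trans (≡⇒≤ (cong (2 +_) (+-comm z 1))) z+3≤s)))
            (λ eq → i≢ (sym (+-suc z o) ⨟ cong (z +_) eq)))

  module _ {T α} (mzs : MinimalZeroSum T) (mult : Multiplicities≤ α T) (8≤α : 8 ≤ α)
           (2≤T : All (2 ≤_) T) where

    open MinimalZeroSum mzs

    private
      rng : ∀ {x L} → x ∷ L ↭ T → x < p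
      rng = proj₂ ∘ in-range mzs

    -- Like no-wrap; the subtraction lands in a gap only for z = p − 1.
    no-wrap-gapped : ∀ {V s z r R} → z ∷ V ++ r ∷ R ↭ T → 2 + z ≤ p → Gapped V s → z + s ≤ suc p
    no-wrap-gapped {V} {s} {z} {r} {R} perm z+2≤p gap with z + s ≤? suc p
    ... | yes h = h
    -- Beyond p + 1 the number p - z is at most s - 2, clear of the upper gap.
    ... | no ¬h with m≤n⇒∃[o]m+o≡n (<⇒≤ (<⇒≤ z+2≤p))
    ...   | i , z+i≡p = ⊥-elim (hit-free mzs [] V R {i} perm
            (gap i (<⇒≤ (<⇒≤ i+2≤s)) (λ { refl → <⇒≢ z+2≤p (sym (+-comm z 1) ⨟ z+i≡p) }) (<⇒≢ i+2≤s))
            (∼-+ (≡⇒∼ (+-identityʳ z)) refl ▸ ≡⇒∼ z+i≡p ▸ p∼0))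
      where
      i+2≤s : 2 + i ≤ s
      i+2≤s = linear 0 (≰⇒> ¬h ⊕ ≡⇒≤ z+i≡p) (arith i p z s)
        where
        arith : ∀ i p z s → 2 + i + (z + s + p) + 0 ≡ s + (2 + p + (z + i))
        arith = solve-∀

    -- The counterpart of `closure`, with ceiling p + 1. Whatever stays outside V is at least
    -- `sum V` - 2, hence at least 5.
    gapped-closure : ∀ n V W → length W ≤ n → V ++ W ↭ T → Gapped V (sum V) → sum V ≤ suc p → 7 ≤ sum V →
      sum T ≤ 2 * p ⊎ ∃₂ λ V w → ∃ λ W → V ++ w ∷ W ↭ T × Gapped V (sum V) × sum V ≤ suc p × 7 ≤ sum V ×
        All (λ x → sum V ≤ 2 + x) (w ∷ W)
    gapped-closure n V [] len perm gap V≤ 7≤ = inj₁ (≤-trans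
      (≡⇒≤ (sum-T mzs V [] perm ⨟ +-identityʳ (sum V)))
      (≤-trans V≤ (≤-trans (+-monoˡ-≤ p (<⇒≤ (<-trans (s≤s (s≤s z≤n)) 2<p))) (≡⇒≤ (cong (p +_) (sym (+-identityʳ p)))))))
    gapped-closure zero V (w ∷ W) () perm gap V≤ 7≤
    gapped-closure (suc n) V (w ∷ W) len perm gap V≤ 7≤ with any? (λ x → 3 + x ≤? sum V) (w ∷ W)
    ... | no none = inj₂ (V , w , W , perm , gap , V≤ , 7≤ , All.map (λ h → ≤-pred (≰⇒> h)) (All.¬Any⇒All¬ (w ∷ W) none))
    ... | yes some with find some
    ...   | x , x∈W , x+3≤ with pick x∈W
    ...     | M , wW↭x = next M wW↭x
      where
      perm-x : ∀ {M} → w ∷ W ↭ x ∷ M → x ∷ V ++ M ↭ T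
      perm-x wW↭x = ↭-trans (↭-sym (↭.shift x V _)) (↭-trans (↭.++⁺ˡ V (↭-sym wW↭x)) perm)
      x+2≤p : 2 + x ≤ p
      x+2≤p = ≤-pred (≤-trans x+3≤ V≤)
      next : ∀ M → w ∷ W ↭ x ∷ M → _
      next [] wW↭x = inj₁ (≤-trans (≡⇒≤ (sum-T mzs V (w ∷ W) perm ⨟ cong (sum V +_) (sum-↭ wW↭x)))
        (linear 1 (x+2≤p ⊕ V≤) (arith (sum V) x p)))
        where
        arith : ∀ s x p → s + (x + 0) + (p + suc p) + 1 ≡ 2 * p + (2 + x + s)
        arith = solve-∀
      next (r ∷ M) wW↭x = gapped-closure n (x ∷ V) (r ∷ M) (≤-pred (≤-trans (≡⇒≥ (↭.↭-length wW↭x)) len))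
        (perm-x wW↭x)
        (gapped-∷ {V} gap (All.head (↭.All-resp-↭ (↭-sym (perm-x wW↭x)) 2≤T)) x+3≤)
        (no-wrap-gapped (perm-x wW↭x) x+2≤p gap) (≤-trans 7≤ (m≤n+m (sum V) x))

    module _ {A B Q} (5≤A : 5 ≤ A) (5≤B : 5 ≤ B) (A∨B : A ≡ α ⊎ B ≡ α)
             (T↭ : T ↭ replicate A 2 ++ replicate B 3 ++ Q) where

      private
        -- Outside terms are at least 5, so V holds all A twos and B threes. In `sum V` - |V| each
        -- two counts 1, each three 2, and any other term counts positively; the inequality is twice
        -- this.
        contents : ∀ V {W} → V ++ W ↭ T → 7 ≤ sum V → All (λ x → sum V ≤ 2 + x) W →
          2 * A + 4 * B + 2 * length V ≤ 2 * sum V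
        contents V {W} perm 7≤ large with take-all A (↭-trans perm T↭) (All.map (λ { h refl → <⇒≱ (m≤m+n 5 2) (≤-trans 7≤ h) }) large)
        ... | V₁ , V↭ , perm₁ with take-all B perm₁ (All.map (λ { h refl → <⇒≱ (m≤m+n 6 1) (≤-trans 7≤ h) }) large)
        ...   | V₂ , V₁↭ , _ = linear 0
          (2 ⊗ sum-≥ 2 (All.++⁻ʳ (replicate B 3) (↭.All-resp-↭ V₁↭ (All.++⁻ʳ (replicate A 2) (↭.All-resp-↭ V↭
                 (All.++⁻ˡ V (↭.All-resp-↭ (↭-sym perm) 2≤T))))))
           ⊕ 2 ⊗ ≡⇒≥ (sum-↭ V↭ ⨟ sum-++ (replicate A 2) V₁ ⨟ cong₂ _+_ (sum-replicate A 2)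
                 (sum-↭ V₁↭ ⨟ sum-++ (replicate B 3) V₂ ⨟ cong (_+ sum V₂) (sum-replicate B 3)))
           ⊕ 2 ⊗ ≡⇒≤ (↭.↭-length V↭ ⨟ length-++ (replicate A 2) ⨟ cong₂ _+_ (length-replicate A)
                 (↭.↭-length V₁↭ ⨟ length-++ (replicate B 3) ⨟ cong (_+ length V₂) (length-replicate B)))
           ⊕ z≤n {2 * length V₂})
          (arith A B (length V) (sum V) (length V₂) (sum V₂))
          where
          arith : ∀ A B l s m t → 2 * A + 4 * B + 2 * l + (2 * t + 2 * s + 2 * (A + (B + m)) + 2 * m) + 0
            ≡ 2 * s + (2 * (2 * m) + 2 * (A * 2 + (B * 3 + t)) + 2 * l + 0)
          arith = solve-∀

        -- The runs [2, s - 3] and z + [3, s - 2] avoid the gaps and have s - 4 points each. The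
        -- second stays below p because z + s ≤ p + 1, and they are disjoint because s ≤ z + 2. The
        -- size bound then gives 2A + 4B ≤ 12 + α, impossible when both counts are at least 5 and
        -- one is α.
        crowded : ∀ V z r R → z ∷ V ++ r ∷ R ↭ T → Gapped V (sum V) → sum V ≤ suc p → 7 ≤ sum V →
          2 + z ≤ p → sum V ≤ 2 + z → 2 * A + 4 * B + 2 * length V ≤ 2 * sum V → ⊥
        crowded V z r R perm gap V≤ 7≤ z+2≤p V≤z many with m≤n⇒∃[o]m+o≡n (≤-trans (m≤m+n 5 2) 7≤)
        ... | m , eq = absurd-cases A∨B
          where
          s : ℕ
          s = sum V
          5+m≤2+z : 5 + m ≤ 2 + z
          5+m≤2+z = ≤-trans (≡⇒≤ eq) V≤z
          z+m<p : 4 + (z + m) ≤ p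
          z+m<p = linear 0 (no-wrap-gapped {V} {s} perm z+2≤p gap ⊕ ≡⇒≤ eq) (arith z s p m)
            where
            arith : ∀ z s p m → 4 + (z + m) + (suc p + s) + 0 ≡ p + (z + s + (5 + m))
            arith = solve-∀
          two : 2 * suc m ≤ size (z ∷ V)
          two = size-intervals (z ∷ V) m (2 ∷ (3 + z) ∷ [])
            (≤-trans (s≤s (s≤s (s≤s (m≤n+m m (suc z))))) z+m<p ∷ z+m<p ∷ [])
            ((inj₁ (≤-trans (m≤n+m (3 + m) 2) (≤-trans 5+m≤2+z (n≤1+n _))) ∷ []) ∷ [] ∷ [])
            ((λ i i≤m → hit-keep (z ∷ []) V (2 + i)
                (gap (2 + i) (≤-trans (s≤s (s≤s (≤-trans i≤m (m≤n+m m 3)))) (≡⇒≤ eq)) (λ ())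
                  (<⇒≢ (≤-trans (s≤s (s≤s (s≤s (s≤s (≤-trans i≤m (n≤1+n m)))))) (≡⇒≤ eq)))))
             ∷ (λ i i≤m → hit-add (z ∷ []) V (3 + i) (≡⇒∼ (shuffle z i))
                (gap (3 + i) (≤-trans (s≤s (s≤s (s≤s (≤-trans i≤m (m≤n+m m 2))))) (≡⇒≤ eq)) (λ ())
                  (<⇒≢ (≤-trans (s≤s (s≤s (s≤s (s≤s (s≤s i≤m))))) (≡⇒≤ eq)))))
             ∷ [])
            where
            shuffle : ∀ z i → (z + 0) + (3 + i) ≡ 3 + z + i
            shuffle = solve-∀
          total≤ : 2 * A + 4 * B ≤ 12 + α
          total≤ = linear 0 (two ⊕ bound mzs mult 8≤α (z ∷ V) (r ∷ R) perm ⊕ many ⊕ 2 ⊗ ≡⇒≥ eq)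
            (arith A B (length V) s α m (size (z ∷ V)))
            where
            arith : ∀ A B l s α m n → 2 * A + 4 * B + (n + (2 + 2 * suc l + α) + 2 * s + 2 * (5 + m)) + 0
              ≡ 12 + α + (2 * suc m + n + (2 * A + 4 * B + 2 * l) + 2 * s)
            arith = solve-∀
          absurd-cases : A ≡ α ⊎ B ≡ α → ⊥
          absurd-cases (inj₁ A≡α) = absurd (A + 7) (total≤ ⊕ ≡⇒≥ A≡α ⊕ 4 ⊗ 5≤B) (arith A B α)
            where
            arith : ∀ A B α → 2 * A + 4 * B + α + 20 ≡ suc (12 + α + A + 4 * B + (A + 7))
            arith = solve-∀
          absurd-cases (inj₂ B≡α) = absurd (2 * B + 2) (total≤ ⊕ ≡⇒≥ B≡α ⊕ 2 ⊗ 5≤A ⊕ 5≤B) (arith A B α)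
            where
            arith : ∀ A B α → 2 * A + 4 * B + α + 10 + 5 ≡ suc (12 + α + B + 2 * A + B + (2 * B + 2))
            arith = solve-∀

      T↭223 : ∃ λ W → 2 ∷ 2 ∷ 3 ∷ W ↭ T
      T↭223 with m≤n⇒∃[o]m+o≡n (≤-trans (m≤m+n 2 3) 5≤A) | m≤n⇒∃[o]m+o≡n (≤-trans (m≤m+n 1 4) 5≤B)
      ... | a , refl | b , refl = replicate a 2 ++ replicate b 3 ++ Q ,
        ↭-trans (prep 2 (prep 2 (↭-sym (↭.shift 3 (replicate a 2) (replicate b 3 ++ Q))))) (↭-sym T↭)

      done-gapped : Done T
      done-gapped = start T↭223
        where
        6≤p : 6 ≤ p
        6≤p = ≤-trans (m≤m+n 6 151) 157≤p

        -- Two terms p - 1 and a two from V sum to 2p; V has another term since `sum V` ≥ 7, so this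
        -- zero-sum subsequence is proper.
        two-minus-ones : ∀ V z z' R → V ++ z ∷ z' ∷ R ↭ T → 7 ≤ sum V → All (λ x → sum V ≤ 2 + x) (z ∷ z' ∷ R) →
          suc z ≡ p → suc z' ≡ p → ⊥
        two-minus-ones V z z' R perm 7≤ large eq eq'
          with take-out (↭-trans perm (↭-sym (proj₂ T↭223)))
                 (All.map (λ { h refl → <⇒≱ (m≤m+n 5 2) (≤-trans 7≤ h) }) large)
        ... | [] , V↭ , _ = <⇒≱ (m≤m+n 3 4) (≤-trans 7≤ (≡⇒≤ (sum-↭ V↭)))
        ... | v ∷ V₂ , V↭ , _ = minimal {2} {z ∷ z' ∷ []} {v} {V₂ ++ R}
          (↭-trans (rearrange 5 (λ t zz v V R → (t ∪ zz) ∪ v ∪ V ∪ R ≐ (t ∪ v ∪ V) ∪ zz ∪ R)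
                     ↭-refl (2 ◂ ∅) (z ◂ z' ◂ ∅) (v ◂ ∅) V₂ R)
            (↭-trans (↭.++⁺ʳ (z ∷ z' ∷ R) (↭-sym V↭)) perm))
          (≡⇒∼ (arith z z' ⨟ cong₂ (λ a b → a + (b + 0)) eq eq') ▸ n*p∼0 2)
          where
          arith : ∀ z z' → 2 + (z + (z' + 0)) ≡ suc z + (suc z' + 0)
          arith = solve-∀

        finish : ∀ V z W → V ++ z ∷ W ↭ T → Gapped V (sum V) → sum V ≤ suc p → 7 ≤ sum V →
          All (λ x → sum V ≤ 2 + x) (z ∷ W) → Done T
        -- Here (p - 1) + (p + 1) = 2p is exactly enough.
        finish V z [] perm gap V≤ 7≤ large = done₁ T (≤-trans
          (≡⇒≤ (sum-T mzs V (z ∷ []) perm))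
          (linear 0 (rng (↭-trans (↭-sym (↭.shift z V [])) perm) ⊕ V≤) (arith (sum V) z p)))
          where
          arith : ∀ s z p → s + (z + 0) + (p + suc p) + 0 ≡ 2 * p + (suc z + s)
          arith = solve-∀
        finish V z (z' ∷ R) perm gap V≤ 7≤ large@(hz ∷ hz' ∷ _) with 2 + z ≤? p | 2 + z' ≤? p
        ... | yes h | _ = ⊥-elim (crowded V z z' R perm-z gap V≤ 7≤ h hz (contents V perm 7≤ large))
          where
          perm-z : z ∷ V ++ z' ∷ R ↭ T
          perm-z = ↭-trans (↭-sym (↭.shift z V (z' ∷ R))) perm
        ... | no _ | yes h = ⊥-elim (crowded V z' z R perm-z' gap V≤ 7≤ h hz' (contents V perm 7≤ large))
          where
          perm-z' : z' ∷ V ++ z ∷ R ↭ T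
          perm-z' = ↭-trans (rearrange 4 (λ y V z R → y ∪ V ∪ z ∪ R ≐ V ∪ z ∪ y ∪ R) ↭-refl (z' ◂ ∅) V (z ◂ ∅) R) perm
        ... | no h | no h' = ⊥-elim (two-minus-ones V z z' R perm 7≤ large
          (≤-antisym (rng {z} (↭-trans (↭-sym (↭.shift z V (z' ∷ R))) perm)) (≤-pred (≰⇒> h)))
          (≤-antisym (rng {z'} (↭-trans (rearrange 4 (λ y V z R → y ∪ V ∪ z ∪ R ≐ V ∪ z ∪ y ∪ R) ↭-refl (z' ◂ ∅) V (z ◂ ∅) R) perm))
            (≤-pred (≰⇒> h'))))

        start : (∃ λ W → 2 ∷ 2 ∷ 3 ∷ W ↭ T) → Done T
        start (W , perm) with gapped-closure (length W) (2 ∷ 2 ∷ 3 ∷ []) W ≤-refl perm gapped-base (s≤s 6≤p) ≤-refl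
        ... | inj₁ small = done₁ T small
        ... | inj₂ (V , z , W , perm , gap , V≤ , 7≤ , large) = finish V z W perm gap V≤ 7≤ large

  -- If 1 occurs, that 1, a two and the α equal terms meet `done-with-unit`; otherwise all terms are
  -- at least 2 and the gapped intervals apply.
  done-two-three : ∀ {T α A B Q} → MinimalZeroSum T → Multiplicities≤ α T → 8 ≤ α →
    5 ≤ A → 5 ≤ B → A ≡ α ⊎ B ≡ α → T ↭ replicate A 2 ++ replicate B 3 ++ Q → Done T
  done-two-three {T} {α} {A} {B} {Q} mzs mult 8≤α 5≤A 5≤B A∨B T↭ with any? (1 ≟_) T
  ... | no none = done-gapped mzs mult 8≤α
          (All.zipWith (λ ((1≤x , _) , 1≢x) → ≤∧≢⇒< 1≤x 1≢x) (MinimalZeroSum.range mzs , All.¬Any⇒All¬ T none))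
          5≤A 5≤B A∨B T↭
  ... | yes 1∈T with pick 1∈T
  ...   | M , T↭1 = unit-case A∨B (pick (2∈ (↭.∈-resp-↭ (↭-trans (↭-sym T↭) T↭1) (∈-++⁺ˡ (2∈rep 5≤A)))))
    where
    2∈rep : ∀ {n} → 5 ≤ n → 2 ∈ replicate n 2
    2∈rep (s≤s _) = here refl
    2∈ : 2 ∈ 1 ∷ M → 2 ∈ M
    2∈ (there h) = h
    T↭12 : ∀ {N} → M ↭ 2 ∷ N → T ↭ 1 ∷ 2 ∷ N
    T↭12 M↭ = ↭-trans T↭1 (prep 1 M↭)
    unit-case : A ≡ α ⊎ B ≡ α → (∃ λ N → M ↭ 2 ∷ N) → Done T
    unit-case (inj₁ refl) (N , M↭) = done-with-unit mzs mult 8≤α ≤-refl (n≤1+n 2) (s≤s z≤n) ≤-refl (T↭12 M↭) T↭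
    unit-case (inj₂ refl) (N , M↭) = done-with-unit mzs mult 8≤α (n≤1+n 2) ≤-refl (s≤s z≤n) ≤-refl (T↭12 M↭)
      (↭-trans T↭ (↭.shifts (replicate A 2) (replicate B 3)))

-- Two dominant values, 1 and k

module Concentrated (p : ℕ) {{_ : NonZero p}} (p-prime : Prime p) (157≤p : 157 ≤ p) where

  open UnitPresent p p-prime 157≤p
  open TwosAndThrees p p-prime 157≤p

  open Mod p
  open Residues p p-prime
  open Sequences p p-prime
  open Multiplicity p p-prime
  open Closure p p-prime 2<p
  open Rescaling p p-prime 2<p

  3<p : 3 < p
  3<p = ≤-trans (m≤m+n 4 153) 157≤p

  interval-ones : ∀ α → Interval (replicate α 1) α
  interval-ones zero    zero _ = hit-zero []
  interval-ones (suc α) = interval-∷ (1 ∷ []) (replicate α 1) (interval-ones α) refl (s≤s z≤n)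

  module _ {T α β k x R} (mzs : MinimalZeroSum T) (mult : Multiplicities≤ α T) (8≤α : 8 ≤ α)
           (α≤β+3 : α ≤ 3 + β) (k≥ : 2 + α ≤ k)
           (T↭ : T ↭ replicate α 1 ++ replicate β k ++ x ∷ R) where

    open MinimalZeroSum mzs

    private
      ones : List ℕ
      ones = replicate α 1

      5≤β : 5 ≤ β
      5≤β = +-cancelˡ-≤ 3 5 β (≤-trans 8≤α α≤β+3)

      copies : ∀ i j → i + j ≤ β → ∃ λ S → replicate i k ++ (replicate j k ++ ones) ++ x ∷ S ↭ T
      copies i j h with m≤n⇒∃[o]m+o≡n h
      ... | o , refl = replicate o k ++ R , ↭-trans
        (rearrange 6 (λ I J O x K R → I ∪ (J ∪ O) ∪ x ∪ K ∪ R ≐ O ∪ ((I ∪ J) ∪ K) ∪ x ∪ R)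
          ↭-refl (replicate i k) (replicate j k) ones (x ◂ ∅) (replicate o k) R)
        (↭-trans (↭.++⁺ˡ ones (↭.++⁺ʳ (x ∷ R) (↭-reflexive (cong (_++ replicate o k) (sym (replicate-+ i j k))
                   ⨟ sym (replicate-+ (i + j) o k))))) (↭-sym T↭))

      size-copies : ∀ i j → i + j ≤ β →
        size (replicate i k ++ replicate j k ++ ones) ≤ 2 + 2 * (i + (j + α)) + α
      size-copies i j h with copies i j h
      ... | S , perm = subst (λ l → size (replicate i k ++ replicate j k ++ ones) ≤ 2 + 2 * l + α)
        (length-++ (replicate i k) ⨟ cong₂ _+_ (length-replicate i)
          (length-++ (replicate j k) ⨟ cong₂ _+_ (length-replicate j) (length-replicate α)))
        (bound mzs mult 8≤α (replicate i k ++ replicate j k ++ ones) (x ∷ S)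
          (↭-trans (↭-reflexive (++-assoc (replicate i k) _ _)) perm))

      clear : ∀ i j {v M} → suc i + j ≤ β → suc i * k ∼ v → v < p →
        Interval (replicate j k ++ ones) M → v + M < p
      clear i j h ik∼v v<p int with copies (suc i) j h
      ... | S , perm = no-wrap mzs (replicate i k) (replicate j k ++ ones) S perm
        (≡⇒∼ (sum-replicate (suc i) k) ▸ ik∼v) v<p int

      k<p : k < p
      k<p with copies 1 0 (≤-trans (m≤m+n 1 4) 5≤β)
      ... | S , perm = proj₂ (in-range mzs perm)

      k≁ : ∀ {c} → 1 ≤ c → c < k → ¬ k ∼ c
      k≁ 1≤c c<k h = <⇒≢ c<k (sym (∼⇒≡ k<p (<-trans c<k k<p) h))

      small<k : ∀ {c} → c ≤ 9 → c < k
      small<k c≤9 = ≤-trans (s≤s c≤9) (≤-trans (s≤s (s≤s 8≤α)) k≥)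

      1k∼k : 1 * k ∼ k
      1k∼k = ≡⇒∼ (*-identityˡ k)

      -- Without wrapping w = u + v > u + M; with wrapping w = u + v - p, and v + M < p gives w + M
      -- < u.
      apart-sum : ∀ {M u v w} → u < p → v < p → w < p → u + v ∼ w →
        M < u → M < v → u + M < p → v + M < p → Apart M u w
      apart-sum {M} {u} {v} {w} u<p v<p w<p eq M<u M<v u+M<p v+M<p with u + v <? p
      ... | yes h = inj₁ (≤-trans (+-monoʳ-< u M<v) (≡⇒≤ (∼⇒≡ h w<p eq)))
      ... | no h with m≤n⇒∃[o]m+o≡n (≮⇒≥ h)
      ...   | o , e = inj₂ (subst (λ w → w + M < u) o≡w (linear 0 (≡⇒≤ e ⊕ v+M<p) (arith o M u v p)))
        where
        o≡w : o ≡ w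
        o≡w = ∼⇒≡ (+-cancelˡ-< p o p (subst (_< p + p) (sym e) (+-mono-< u<p v<p))) w<p
          (sym (p+∼ o) ▸ ≡⇒∼ e ▸ eq)
        arith : ∀ o M u v p → suc (o + M) + (u + v + p) + 0 ≡ u + (p + o + suc (v + M))
        arith = solve-∀

      rescaled : ∀ {c w} → ¬ c ∼ 0 → c < p → c * k ∼ w → w < p →
        rescale c T ↭ replicate α c ++ replicate β w ++ rescale c (x ∷ R)
      rescaled {c} {w} c≁0 c<p ck∼w w<p = subst (rescale c T ↭_)
        (rescale-replicate c α 1 _ ⨟ cong₂ (λ a L → replicate α a ++ L)
          (cong (_% p) (*-identityʳ c) ⨟ m<n⇒m%n≡m c<p)
          (rescale-replicate c β k (x ∷ R) ⨟ cong (λ a → replicate β a ++ rescale c (x ∷ R))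
            (ck∼w ⨟ m<n⇒m%n≡m w<p)))
        (↭.map⁺ _ T↭)

      -- Multiplying by c turns the copies of k into ones and the ones into α copies of c.
      unit-multiple : ∀ {c} → 2 ≤ c → c ≤ 3 → c * k ∼ 1 → Done T
      unit-multiple {c} 2≤c c≤3 ck∼1 = rescale-done c≁0 mzs (done-with-unit
          (rescale-mzs c≁0 mzs) (rescale-multiplicities c≁0 mzs mult) 8≤α 2≤c c≤3 ≤-refl (n≤1+n 1)
          (proj₂ two-units) scaled-T)
        where
        c<p : c < p
        c<p = ≤-<-trans c≤3 3<p
        c≁0 : ¬ c ∼ 0
        c≁0 = ≁0 (≤-trans (n≤1+n 1) 2≤c) c<p
        scaled-T : rescale c T ↭ replicate α c ++ replicate β 1 ++ rescale c (x ∷ R)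
        scaled-T = rescaled c≁0 c<p ck∼1 (<-trans (s≤s (s≤s z≤n)) 2<p)
        two-units : ∃ λ Q → rescale c T ↭ 1 ∷ 1 ∷ Q
        two-units with m≤n⇒∃[o]m+o≡n (≤-trans (m≤m+n 2 3) 5≤β)
        ... | b , eq = replicate α c ++ replicate b 1 ++ rescale c (x ∷ R) , ↭-trans scaled-T
          (subst (λ b' → replicate α c ++ replicate b' 1 ++ rescale c (x ∷ R) ↭ _) eq
            (↭.shifts (replicate α c) (1 ∷ 1 ∷ [])))

      halves : 2 * k ∼ 3 → Done T
      halves h = rescale-done 2≁0 mzs (done-two-three (rescale-mzs 2≁0 mzs) (rescale-multiplicities 2≁0 mzs mult) 8≤α
          (≤-trans (m≤m+n 5 3) 8≤α) 5≤β (inj₁ refl) (rescaled 2≁0 2<p h 3<p))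
        where
        2≁0 : ¬ 2 ∼ 0
        2≁0 = ≁0 (s≤s z≤n) 2<p

      thirds : 3 * k ∼ 2 → Done T
      thirds h = rescale-done 3≁0 mzs (done-two-three (rescale-mzs 3≁0 mzs) (rescale-multiplicities 3≁0 mzs mult) 8≤α
          5≤β (≤-trans (m≤m+n 5 3) 8≤α) (inj₂ refl)
          (↭-trans (rescaled 3≁0 3<p h 2<p) (↭.shifts (replicate α 3) (replicate β 2))))
        where
        3≁0 : ¬ 3 ∼ 0
        3≁0 = ≁0 (s≤s z≤n) 3<p

      cancel : ∀ c {w} → 1 ≤ c → c < p → c * k ∼ w * c → k ∼ w
      cancel c 1≤c c<p h = ∼-cancel-* (≁0 1≤c c<p) (≡⇒∼ (*-comm k c) ▸ h)

      doubles : ∀ {w} q → 2 * k ∼ w → w ≤ suc α → Interval (replicate (q * 2) k ++ ones) (q * w + α)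
      doubles zero    h w≤ = interval-ones α
      doubles {w} (suc q) h w≤ = subst (Interval (replicate (suc q * 2) k ++ ones)) (sym (+-assoc w (q * w) α))
        (interval-∷ (k ∷ k ∷ []) (replicate (q * 2) k ++ ones) (doubles q h w≤) h (≤-trans w≤ (s≤s (m≤n+m α (q * w)))))

      -- With M = q w + α, 2q copies of k and the ones fill [0, M], and one more k adds the
      -- translate by k. The two are disjoint, as k ≤ M would give 2k ≤ k + M < p. The conclusion is
      -- 2(M + 1) ≤ 2 + 2(1 + 2q + α) + α rewritten.
      near-half-bound : ∀ {w} q → 2 * k ≡ p + w → w ≤ suc α → 1 + q * 2 ≤ β → q * w + q * w ≤ 2 + 4 * q + α
      near-half-bound {w} q eq w≤ q≤ = linear 0
          (size-intervals (k ∷ replicate (q * 2) k ++ ones) M (0 ∷ k ∷ [])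
            (≤-<-trans (m≤n+m M k) k+M<p ∷ k+M<p ∷ []) ((inj₁ M<k ∷ []) ∷ [] ∷ [])
            ((λ i i≤ → hit-keep (k ∷ []) (replicate (q * 2) k ++ ones) i (int i i≤))
             ∷ (λ i i≤ → hit-add (k ∷ []) (replicate (q * 2) k ++ ones) i (∼-+ (≡⇒∼ (+-identityʳ k)) refl) (int i i≤)) ∷ [])
           ⊕ size-copies 1 (q * 2) q≤)
          (arith (q * w) q α (size (k ∷ replicate (q * 2) k ++ ones)))
        where
        2k∼w : 2 * k ∼ w
        2k∼w = ≡⇒∼ eq ▸ p+∼ w
        M : ℕ
        M = q * w + α
        int : Interval (replicate (q * 2) k ++ ones) M
        int = doubles q 2k∼w w≤
        k+M<p : k + M < p
        k+M<p = clear 0 (q * 2) q≤ 1k∼k k<p int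
        M<k : M < k
        M<k with M <? k
        ... | yes h = h
        ... | no h = absurd w (k+M<p ⊕ ≮⇒≥ h ⊕ ≡⇒≥ eq) (arith₁ k M p w)
          where
          arith₁ : ∀ k M p w → suc (k + M) + k + (p + w) ≡ suc (p + M + 2 * k + w)
          arith₁ = solve-∀
        arith : ∀ e q α n → e + e + (n + (2 + 2 * (1 + (q * 2 + α)) + α)) + 0 ≡ 2 + 4 * q + α + (2 * suc (e + α) + n)
        arith = solve-∀

      half-of : ∀ β → 1 ≤ β → ∃ λ q → 1 + q * 2 ≤ β × β ≤ 2 + q * 2
      half-of (suc zero)    _ = 0 , ≤-refl , n≤1+n 1
      half-of (suc (suc zero)) _ = 0 , n≤1+n 1 , ≤-refl
      half-of (suc (suc (suc β))) _ with half-of (suc β) (s≤s z≤n)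
      ... | q , h , g = suc q , s≤s (s≤s h) , s≤s (s≤s g)

      -- w = 2 and w = 4 would make k equal to 1 or 2, against k ≥ α + 2. For w ≥ 5 take q as large
      -- as β permits: 10q ≤ 2 + 4q + α and α ≤ 2q + 5 leave q ≤ 1, and then β ≤ 4 contradicts α ≥
      -- 8.
      near-half : ∀ w → 2 * k ≡ p + w → 1 ≤ w → w ≤ suc α → Done T
      near-half zero eq () w≤
      near-half 1 eq _ w≤ = unit-multiple ≤-refl (n≤1+n 2) (≡⇒∼ eq ▸ p+∼ 1)
      near-half 2 eq _ w≤ = ⊥-elim (k≁ ≤-refl (small<k (m≤m+n 1 8)) (cancel 2 (s≤s z≤n) 2<p (≡⇒∼ eq ▸ p+∼ 2)))
      near-half 3 eq _ w≤ = halves (≡⇒∼ eq ▸ p+∼ 3)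
      near-half 4 eq _ w≤ = ⊥-elim (k≁ (s≤s z≤n) (small<k (m≤m+n 2 7)) (cancel 2 (s≤s z≤n) 2<p (≡⇒∼ eq ▸ p+∼ 4)))
      near-half w@(suc (suc (suc (suc (suc w'))))) eq _ w≤ with half-of β (≤-trans (m≤m+n 1 4) 5≤β)
      ... | q , q≤ , β≤ = large-q q (near-half-bound q eq w≤ q≤) β≤
        where
        5q≤ : ∀ q → q * 5 ≤ q * w
        5q≤ q = *-monoʳ-≤ q (m≤m+n 5 w')
        large-q : ∀ q → q * w + q * w ≤ 2 + 4 * q + α → β ≤ 2 + q * 2 → Done T
        large-q zero    h β≤ = absurd 2 (5≤β ⊕ β≤) (arith β)
          where
          arith : ∀ β → 5 + β ≡ suc (β + (2 + 0 * 2) + 2)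
          arith = solve-∀
        large-q (suc zero) h β≤ = absurd 0 (8≤α ⊕ α≤β+3 ⊕ β≤) (arith α β)
          where
          arith : ∀ α β → 8 + α + β ≡ suc (α + (3 + β) + (2 + 1 * 2) + 0)
          arith = solve-∀
        large-q q@(suc (suc q')) h β≤ = absurd (4 * q') (h ⊕ 5q≤ q ⊕ 5q≤ q ⊕ α≤β+3 ⊕ β≤) (arith q' α β (q * w))
          where
          arith : ∀ q α β e → e + e + suc (suc q) * 5 + suc (suc q) * 5 + α + β
            ≡ suc (2 + 4 * suc (suc q) + α + e + e + (3 + β) + (2 + suc (suc q) * 2) + 4 * q)
          arith = solve-∀

      -- Three copies of k and the ones fill [0, w + α]; two more copies add the translates by k and
      -- v. So 3(w + α + 1) ≤ 3α + 12, that is w ≤ 3, and w = 0 or w = 3 would give k ≡ 0 or k ≡ 1.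
      near-third : ∀ v w → 2 * k ∼ v → v < p → 2 + α ≤ v → 3 * k ∼ w → w ≤ α → Done T
      near-third v w 2k∼v v<p v≥ 3k∼w w≤α = by-value w refl
        where
        M : ℕ
        M = w + α
        P : List ℕ
        P = replicate 3 k ++ ones
        int : Interval P M
        int = interval-∷ (k ∷ k ∷ k ∷ []) ones (interval-ones α) 3k∼w (≤-trans w≤α (n≤1+n α))
        k+M<p : k + M < p
        k+M<p = clear 0 3 (≤-trans (m≤m+n 4 1) 5≤β) 1k∼k k<p int
        v+M<p : v + M < p
        v+M<p = clear 1 3 5≤β 2k∼v v<p int
        k+v∼w : k + v ∼ w
        k+v∼w = ∼-+ˡ k (sym 2k∼v) ▸ 3k∼w
        k+v≮p : ¬ k + v < p
        k+v≮p h = <⇒≱ (≤-trans (s≤s w≤α) (≤-trans (≤-trans (n≤1+n _) v≥) (m≤n+m v k)))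
          (≡⇒≤ (∼⇒≡ h (≤-<-trans (≤-trans w≤α (≤-trans (≤-trans (m≤n+m α 2) v≥) ≤-refl)) v<p) k+v∼w))
        M<k : M < k
        M<k = ≰⇒> λ h → k+v≮p (≤-<-trans (≤-trans (≡⇒≤ (+-comm k v)) (+-monoʳ-≤ v h)) v+M<p)
        M<v : M < v
        M<v = ≰⇒> λ h → k+v≮p (≤-<-trans (+-monoʳ-≤ k h) k+M<p)
        w≤3 : w ≤ 3
        w≤3 = *-cancelˡ-≤ 3 (linear 0
          (size-intervals (k ∷ k ∷ P) M (0 ∷ k ∷ v ∷ [])
            (≤-<-trans (m≤n+m M k) k+M<p ∷ k+M<p ∷ v+M<p ∷ [])
            ((inj₁ M<k ∷ inj₁ M<v ∷ []) ∷ (apart-sum k<p k<p v<p (≡⇒∼ (cong (k +_) (sym (+-identityʳ k))) ▸ 2k∼v) M<k M<k k+M<p k+M<p ∷ []) ∷ [] ∷ [])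
            ((λ i i≤ → hit-keep (k ∷ k ∷ []) P i (int i i≤))
             ∷ (λ i i≤ → hit-keep (k ∷ []) (k ∷ P) (k + i) (hit-add (k ∷ []) P i (∼-+ (≡⇒∼ (+-identityʳ k)) refl) (int i i≤)))
             ∷ (λ i i≤ → hit-add (k ∷ k ∷ []) P i (∼-+ 2k∼v refl) (int i i≤)) ∷ [])
           ⊕ size-copies 2 3 5≤β)
          (arith w α (size (k ∷ k ∷ P))))
          where
          arith : ∀ w α n → 3 * w + (n + (2 + 2 * (2 + (3 + α)) + α)) + 0 ≡ 3 * 3 + (3 * suc (w + α) + n)
          arith = solve-∀
        by-value : ∀ u → w ≡ u → Done T
        by-value 0 refl = ⊥-elim (k≁0 (cancel 3 (s≤s z≤n) 3<p 3k∼w))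
          where
          k≁0 : ¬ k ∼ 0
          k≁0 = ≁0 (≤-trans (s≤s z≤n) k≥) k<p
        by-value 1 refl = unit-multiple (n≤1+n 2) ≤-refl 3k∼w
        by-value 2 refl = thirds 3k∼w
        by-value 3 refl = ⊥-elim (k≁ ≤-refl (small<k (m≤m+n 1 8)) (cancel 3 (s≤s z≤n) 3<p 3k∼w))
        by-value (suc (suc (suc (suc u)))) refl = ⊥-elim (<⇒≱ (m≤m+n 4 u) w≤3)

      -- If the residue of 3k exceeds α, then [0, α] and its translates by the residues of k, 2k and
      -- 3k are disjoint, and 4(α + 1) ≤ 3α + 8 fails.
      far : ∀ v → 2 * k ∼ v → v < p → 2 + α ≤ v → Done T
      far v 2k∼v v<p v≥ with 3 * k % p ≤? α
      ... | yes w≤α = near-third v (3 * k % p) 2k∼v v<p v≥ (sym (%-∼ (3 * k))) w≤α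
      ... | no w≰α = absurd 3 (four ⊕ 8≤α) (arith α)
        where
        arith : ∀ α → 4 * suc α + 8 ≡ suc (2 + 2 * (3 + (0 + α)) + α + α + 3)
        arith = solve-∀
        w : ℕ
        w = 3 * k % p
        w<p : w < p
        w<p = m%n<n (3 * k) p
        3k∼w : 3 * k ∼ w
        3k∼w = sym (%-∼ (3 * k))
        int : Interval ones α
        int = interval-ones α
        k+α<p : k + α < p
        k+α<p = clear 0 0 (≤-trans (m≤m+n 1 4) 5≤β) 1k∼k k<p int
        v+α<p : v + α < p
        v+α<p = clear 1 0 (≤-trans (m≤m+n 2 3) 5≤β) 2k∼v v<p int
        w+α<p : w + α < p
        w+α<p = clear 2 0 (≤-trans (m≤m+n 3 2) 5≤β) 3k∼w w<p int
        α<k : α < k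
        α<k = ≤-trans (n≤1+n _) k≥
        α<v : α < v
        α<v = ≤-trans (n≤1+n _) v≥
        k+v∼w : k + v ∼ w
        k+v∼w = ∼-+ˡ k (sym 2k∼v) ▸ 3k∼w
        four : 4 * suc α ≤ 2 + 2 * (3 + (0 + α)) + α
        four = ≤-trans
          (size-intervals (k ∷ k ∷ k ∷ ones) α (0 ∷ k ∷ v ∷ w ∷ [])
            (≤-<-trans (m≤n+m α k) k+α<p ∷ k+α<p ∷ v+α<p ∷ w+α<p ∷ [])
            ((inj₁ α<k ∷ inj₁ α<v ∷ inj₁ (≰⇒> w≰α) ∷ [])
             ∷ (apart-sum k<p k<p v<p (≡⇒∼ (cong (k +_) (sym (+-identityʳ k))) ▸ 2k∼v) α<k α<k k+α<p k+α<p
                ∷ apart-sum k<p v<p w<p k+v∼w α<k α<v k+α<p v+α<p ∷ [])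
             ∷ (apart-sum v<p k<p w<p (≡⇒∼ (+-comm v k) ▸ k+v∼w) α<v α<k v+α<p k+α<p ∷ []) ∷ [] ∷ [])
            ((λ i i≤ → hit-keep (k ∷ k ∷ k ∷ []) ones i (int i i≤))
             ∷ (λ i i≤ → hit-keep (k ∷ k ∷ []) (k ∷ ones) (k + i) (hit-add (k ∷ []) ones i (∼-+ (≡⇒∼ (+-identityʳ k)) refl) (int i i≤)))
             ∷ (λ i i≤ → hit-keep (k ∷ []) (k ∷ k ∷ ones) (v + i) (hit-add (k ∷ k ∷ []) ones i (∼-+ 2k∼v refl) (int i i≤)))
             ∷ (λ i i≤ → hit-add (k ∷ k ∷ k ∷ []) ones i (∼-+ 3k∼w refl) (int i i≤)) ∷ []))
          (size-copies 3 0 (≤-trans (m≤m+n 3 2) 5≤β))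

    done-two-values : Done T
    done-two-values with <-cmp (2 * k) p
    ... | tri< 2k<p _ _ = far (2 * k) refl 2k<p (≤-trans k≥ (m≤m+n k (k + 0)))
    ... | tri≈ _ 2k≡p _ = ⊥-elim (≁0 (≤-trans (s≤s z≤n) k≥) k<p (cancel 2 {0} (s≤s z≤n) 2<p (≡⇒∼ 2k≡p ▸ p∼0)))
    ... | tri> _ _ p<2k with m≤n⇒∃[o]m+o≡n (<⇒≤ p<2k)
    ...   | v , eq with v ≤? suc α
    ...     | yes v≤ = near-half v (sym eq) (+-cancelˡ-≤ p 1 v (≤-trans (≡⇒≤ (+-comm p 1)) (≤-trans p<2k (≡⇒≥ eq)))) v≤
    ...     | no v≰ = far v (≡⇒∼ (sym eq) ▸ p+∼ v)
                (+-cancelˡ-< p v p (subst (_< p + p) (sym eq) (+-mono-< k<p (subst (_< p) (sym (+-identityʳ k)) k<p))))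
                (≰⇒> v≰)

  -- V contains all ones. Any other terms V' of V are at least 2, so 3(α + 2|V'| + 1) ≤ 3α + 2|V'| +
  -- 6, which forces V' to be empty. For V with x and y, `extend` then gives 3(α + 1) ≤ 2(α + 2) + 2
  -- + m, that is m ≥ α - 3.
  done-one : ∀ {T α Q} → MinimalZeroSum T → Multiplicities≤ α T → 8 ≤ α →
    T ↭ replicate α 1 ++ Q → All (_≢ 1) Q → Done T
  done-one {T} {α} {Q} mzs mult 8≤α T↭ Q≢1 with done-or-violation mzs
  ... | inj₁ done = done
  ... | inj₂ (V , x , y , r , R , perm , int , large , three)
    with take-all α (↭-trans perm T↭) (All.map (λ { h refl → <⇒≱ (s≤s (m≤m+n 1 (sum V))) h }) large)
  ...   | V' , V↭ , perm' = only-ones V' V↭ perm'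
    where
    sum-V : ∀ {V'} → V ↭ replicate α 1 ++ V' → sum V ≡ α + sum V'
    sum-V {V'} V↭ = sum-↭ V↭ ⨟ sum-++ (replicate α 1) V' ⨟ cong (_+ sum V') (sum-replicate α 1 ⨟ *-identityʳ α)
    len-V : ∀ {V'} → V ↭ replicate α 1 ++ V' → length V ≡ α + length V'
    len-V {V'} V↭ = ↭.↭-length V↭ ⨟ length-++ (replicate α 1) ⨟ cong (_+ length V') (length-replicate α)

    Q≥2 : All (2 ≤_) Q
    Q≥2 = All.zipWith (λ ((1≤x , _) , x≢1) → ≤∧≢⇒< 1≤x (≢-sym x≢1))
      (All.++⁻ʳ (replicate α 1) (↭.All-resp-↭ T↭ (MinimalZeroSum.range mzs)) , Q≢1)

    perm-xy : x ∷ y ∷ V ++ r ∷ R ↭ T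
    perm-xy = ↭-trans (rearrange 4 (λ x y V R → x ∪ y ∪ V ∪ R ≐ V ∪ x ∪ y ∪ R) ↭-refl (x ◂ ∅) (y ◂ ∅) V (r ∷ R)) perm

    only-ones : ∀ V' → V ↭ replicate α 1 ++ V' → V' ++ x ∷ y ∷ r ∷ R ↭ Q → Done T
    only-ones (v ∷ V') V↭ perm' = absurd (4 * length V')
      (three ⊕ bound mzs mult 8≤α (x ∷ y ∷ V) (r ∷ R) perm-xy ⊕ 3 ⊗ ≡⇒≥ (sum-V V↭) ⊕ 2 ⊗ ≡⇒≤ (len-V V↭)
       ⊕ 3 ⊗ sum-≥ 2 (All.++⁻ˡ (v ∷ V') (↭.All-resp-↭ (↭-sym perm') Q≥2)))
      (arith (sum V) (size (x ∷ y ∷ V)) (length V) α (sum (v ∷ V')) (length V'))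
      where
      arith : ∀ s n l α t m → 3 * suc s + n + 3 * (α + t) + 2 * l + 3 * (2 * suc m)
        ≡ suc (n + (2 + 2 * (2 + l) + α) + 3 * s + 2 * (α + suc m) + 3 * t + 4 * m)
      arith = solve-∀
    only-ones [] V↭ perm' = finish (extend mzs (length (r ∷ R)) {x ∷ y ∷ V} ≤-refl perm-xy big)
      where
      big : 4 + 2 * length (x ∷ y ∷ V) ≤ size (x ∷ y ∷ V)
      big = linear 3 (three ⊕ 2 ⊗ ≡⇒≤ (len-V V↭) ⊕ 3 ⊗ ≡⇒≥ (sum-V V↭) ⊕ 8≤α)
        (arith (sum V) (length V) α (size (x ∷ y ∷ V)))
        where
        arith : ∀ s l α n → 4 + 2 * (2 + l) + (n + 2 * (α + 0) + 3 * s + α) + 3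
          ≡ n + (3 * suc s + 2 * l + 3 * (α + 0) + 8)
        arith = solve-∀
      finish : (∃₂ λ b m → ∃ λ R' → (x ∷ y ∷ V) ++ replicate m b ++ R' ↭ T × size (x ∷ y ∷ V) ≤ 2 + 2 * length (x ∷ y ∷ V) + m) → Done T
      finish (b , m , R' , permR , many) = done-two-values mzs mult 8≤α α≤3+m (All.lookup rep≥ b∈) T↭'
        where
        α≤3+m : α ≤ 3 + m
        α≤3+m = linear 0 (three ⊕ many ⊕ 3 ⊗ ≡⇒≥ (sum-V V↭) ⊕ 2 ⊗ ≡⇒≤ (len-V V↭))
          (arith (sum V) (size (x ∷ y ∷ V)) (length V) α m)
          where
          arith : ∀ s n l α m → α + (n + (2 + 2 * (2 + l) + m) + 3 * s + 2 * (α + 0)) + 0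
            ≡ 3 + m + (3 * suc s + n + 3 * (α + 0) + 2 * l)
          arith = solve-∀
        T↭' : T ↭ replicate α 1 ++ replicate m b ++ x ∷ y ∷ R'
        T↭' = ↭-trans (↭-sym permR) (↭-trans
          (rearrange 5 (λ x y V B R → (x ∪ y ∪ V) ∪ B ∪ R ≐ V ∪ B ∪ x ∪ y ∪ R) ↭-refl (x ◂ ∅) (y ◂ ∅) V (replicate m b) R')
          (↭.++⁺ʳ _ (↭-trans V↭ (↭.++-identityʳ _))))
        rep≥ : All (2 + α ≤_) (replicate m b)
        rep≥ = All.++⁻ˡ (replicate m b) (↭.All-resp-↭ (↭-trans perm' (cancel-++ (replicate α 1) (↭-trans (↭-sym T↭) T↭')))
          (All.map (≤-trans (≡⇒≤ (cong (2 +_) (sym (sum-V V↭ ⨟ +-identityʳ α))))) large))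
        rep∈ : ∀ {m} → 1 ≤ m → b ∈ replicate m b
        rep∈ (s≤s _) = here refl
        b∈ : b ∈ replicate m b
        b∈ = rep∈ (≤-trans (m≤m+n 1 4) (+-cancelˡ-≤ 3 5 m (≤-trans 8≤α α≤3+m)))

  done : ∀ {T} → MinimalZeroSum T → Done T
  done {[]} mzs = contradiction (≤-trans 157≤p (MinimalZeroSum.long mzs)) (<⇒≱ (s≤s (s≤s z≤n)))
  done {t ∷ T₀} mzs = from-max (argmax (λ i → occ i (t ∷ T₀)) t T₀)
    where
    T : List ℕ
    T = t ∷ T₀
    from-max : (∃ λ a → a ∈ T × All (λ i → occ i T ≤ occ a T) T) → Done T
    from-max (a , a∈T , max) = from-inverse (inverse a≁0)
      where
      a≁0 : ¬ a ∼ 0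
      a≁0 = let (1≤a , a<p) = All.lookup (MinimalZeroSum.range mzs) a∈T in ≁0 1≤a a<p
      α : ℕ
      α = occ a T
      mult : Multiplicities≤ α T
      mult i with 1 ≤? occ i T
      ... | yes h = All.lookup max (occ-positive i T h)
      ... | no h  = ≤-trans (≡⇒≤ (occ-∉ i T h)) z≤n
      8≤α : 8 ≤ α
      8≤α = multiplicity-large mzs 157≤p mult
      from-inverse : (∃ λ d → d * a ∼ 1) → Done T
      from-inverse (d , da∼1) = rescale-done d≁0 mzs
        (split (split-off 1 (rescale d T)))
        where
        d≁0 : ¬ d ∼ 0
        d≁0 h = ≁0 ≤-refl (<-trans (s≤s (s≤s z≤n)) 2<p) (sym da∼1 ▸ ∼-* h refl)
        -- Multiplying by d sends the copies of a to ones. The actual number of ones is used from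
        -- here on, so that splitting them off leaves no 1 behind.
        α≤ : α ≤ occ 1 (rescale d T)
        α≤ with split-off a T
        ... | Q , T↭ , _ = begin
          α                                                       ≡⟨ occ-replicate 1 α ⟨
          occ 1 (replicate α 1)                                   ≤⟨ m≤m+n _ _ ⟩
          occ 1 (replicate α 1) + occ 1 (rescale d Q)             ≡⟨ occ-++ 1 (replicate α 1) _ ⟨
          occ 1 (replicate α 1 ++ rescale d Q)                    ≡⟨ cong (λ u → occ 1 (replicate α u ++ rescale d Q)) da≡1 ⟨
          occ 1 (replicate α (d * a % p) ++ rescale d Q)          ≡⟨ cong (occ 1) (rescale-replicate d α a Q) ⟨
          occ 1 (rescale d (replicate α a ++ Q))                  ≡⟨ occ-↭ 1 (↭.map⁺ _ T↭) ⟨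
          occ 1 (rescale d T)                                     ∎
          where
          open ≤-Reasoning
          da≡1 : d * a % p ≡ 1
          da≡1 = da∼1 ⨟ m<n⇒m%n≡m (<-trans (s≤s (s≤s z≤n)) 2<p)
        split : (∃ λ Q → rescale d T ↭ replicate (occ 1 (rescale d T)) 1 ++ Q × All (_≢ 1) Q) → Done (rescale d T)
        split (Q , perm , Q≢1) = done-one (rescale-mzs d≁0 mzs)
          (λ i → ≤-trans (rescale-multiplicities d≁0 mzs mult i) α≤) (≤-trans 8≤α α≤) perm Q≢1

-- From residues back to the group and the index

open import Defs
open import Data.Integer.Base using (+_)

fraction-≤ : ∀ a m b n .{{_ : NonZero m}} .{{_ : NonZero n}} → a * n ≤ b * m → (+ a) ℚ./ m ℚ.≤ (+ b) ℚ./ n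
fraction-≤ a (suc m) b (suc n) h = ℚ.toℚᵘ-cancel-≤
  (ℚᵘ.≤-respˡ-≃ (ℚᵘ.≃-sym (ℚ.toℚᵘ-fromℚᵘ (ℚᵘ.mkℚᵘ (+ a) m)))
  (ℚᵘ.≤-respʳ-≃ (ℚᵘ.≃-sym (ℚ.toℚᵘ-fromℚᵘ (ℚᵘ.mkℚᵘ (+ b) n)))
    (ℚᵘ.*≤* (subst₂ ℤ._≤_ (ℤ.pos-* a (suc n)) (ℤ.pos-* b (suc m)) (ℤ.+≤+ h)))))

argmin : ∀ (F : ℕ → ℕ) n → ∃ λ c → 1 ≤ c × c ≤ suc n × (∀ d → 1 ≤ d → d ≤ suc n → F c ≤ F d)
argmin F zero = 1 , ≤-refl , ≤-refl , λ d 1≤d d≤1 → ≡⇒≤ (cong F (≤-antisym 1≤d d≤1))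
argmin F (suc n) with argmin F n
... | c , 1≤c , c≤ , min with F c ≤? F (2 + n)
...   | yes h = c , 1≤c , m≤n⇒m≤1+n c≤ , below
  where
  below : ∀ d → 1 ≤ d → d ≤ 2 + n → F c ≤ F d
  below d 1≤d d≤ with d ≟ 2 + n
  ... | yes refl = h
  ... | no ne    = min d 1≤d (≤-pred (≤∧≢⇒< d≤ ne))
...   | no ¬h = 2 + n , s≤s z≤n , ≤-refl , below
  where
  below : ∀ d → 1 ≤ d → d ≤ 2 + n → F (2 + n) ≤ F d
  below d 1≤d d≤ with d ≟ 2 + n
  ... | yes refl = ≤-refl
  ... | no ne    = ≤-trans (<⇒≤ (≰⇒> ¬h)) (min d 1≤d (≤-pred (≤∧≢⇒< d≤ ne)))

-- The only candidate in between, 156, is even.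
prime>155⇒≥157 : ∀ {p} → Prime p → p > 155 → 157 ≤ p
prime>155⇒≥157 {p} p-prime 155<p = ≤∧≢⇒< 155<p 156≢p
  where
  156≢p : 156 ≢ p
  156≢p 156≡p = neither (prime⇒irreducible p-prime (subst (2 ∣_) 156≡p (divides 78 refl)))
    where
    neither : 2 ≡ 1 ⊎ 2 ≡ p → ⊥
    neither (inj₂ 2≡p) = <⇒≱ 155<p (≤-trans (≡⇒≥ 2≡p) (m≤m+n 2 153))

module Cyclic {c ℓ} (G : AbelianGroup c ℓ) (p : ℕ) {{p≢0 : NonZero p}} (p-prime : Prime p) (157≤p : 157 ≤ p)
              (cyclic : IsCyclic G) (cardinality : HasCardinality G p) where

  module G = AbelianGroup G
  open G using (Carrier; _≈_; _∙_; ε)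
  open Mult G.monoid using (×-congʳ; ×-homo-+; ×-assocˡ) renaming (_×_ to _·_)
  open import Relation.Binary.Reasoning.Setoid G.setoid

  open UnitPresent p p-prime 157≤p using (2<p)
  open Mod p
  open Residues p p-prime
  open Sequences p p-prime
  open Closure p p-prime 2<p
  open Rescaling p p-prime 2<p
  open Concentrated p p-prime 157≤p using (done)

  private
    module Card = Inverse cardinality

    g₀ : Carrier
    g₀ = proj₁ cyclic

  ·-zero : ∀ m → m · ε ≈ ε
  ·-zero zero    = G.refl
  ·-zero (suc m) = G.trans (G.identityˡ _) (·-zero m)

  ·-congˡ : ∀ {m n} x → m ≡ n → m · x ≈ n · x
  ·-congˡ x refl = G.refl

  ·-% : ∀ {n} .{{_ : NonZero n}} {x} → n · x ≈ ε → ∀ k → k · x ≈ (k % n) · x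
  ·-% {n} {x} nx≈ε k = begin
    k · x                             ≈⟨ ·-congˡ x (m≡m%n+[m/n]*n k n) ⟩
    (k % n + k / n * n) · x           ≈⟨ ×-homo-+ x (k % n) (k / n * n) ⟩
    (k % n) · x ∙ (k / n * n) · x     ≈⟨ G.∙-congˡ (×-assocˡ x (k / n) n) ⟨
    (k % n) · x ∙ (k / n) · (n · x)   ≈⟨ G.∙-congˡ (G.trans (×-congʳ (k / n) nx≈ε) (·-zero (k / n))) ⟩
    (k % n) · x ∙ ε                   ≈⟨ G.identityʳ _ ⟩
    (k % n) · x                       ∎

  -- Pigeonhole on the p + 1 multiples 0 x, ..., p x.
  finite-order : ∀ x → ∃ λ n → 1 ≤ n × n ≤ p × n · x ≈ ε
  finite-order x with Fin.pigeonhole (n<1+n p) (λ i → Card.from (Fin.toℕ i · x))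
  ... | i , j , i<j , eq with m≤n⇒∃[o]m+o≡n i<j
  ...   | o , suc-i+o≡j = suc o , s≤s z≤n ,
    ≤-trans (m≤n+m (suc o) (Fin.toℕ i)) (≤-trans (≡⇒≤ i+suc-o≡j) (≤-pred (Fin.toℕ<n j))) ,
    GroupProperties.identityʳ-unique G.group (Fin.toℕ i · x) (suc o · x) (begin
      Fin.toℕ i · x ∙ suc o · x                      ≈⟨ ×-homo-+ x (Fin.toℕ i) (suc o) ⟨
      (Fin.toℕ i + suc o) · x                        ≈⟨ ·-congˡ x i+suc-o≡j ⟩
      Fin.toℕ j · x                                  ≈⟨ Card.strictlyInverseˡ _ ⟨
      Card.to (Card.from (Fin.toℕ j · x))            ≈⟨ Card.to-cong eq ⟨
      Card.to (Card.from (Fin.toℕ i · x))            ≈⟨ Card.strictlyInverseˡ _ ⟩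
      Fin.toℕ i · x                                  ∎)
    where
    i+suc-o≡j : Fin.toℕ i + suc o ≡ Fin.toℕ j
    i+suc-o≡j = +-suc (Fin.toℕ i) o ⨟ suc-i+o≡j

  -- Once n x vanishes, inverses are natural multiples as well: -(a x) = (n - 1) a x.
  multiple : ∀ {n x y} → 1 ≤ n → n · x ≈ ε → ⟨_⟩₁ G x y → ∃ λ k → y ≈ k · x
  multiple _ _ (gen y≈x) = 1 , G.trans y≈x (G.sym (G.identityʳ _))
  multiple _ _ unit = 0 , G.refl
  multiple {x = x} 1≤n nx≈ε (mul h k) with multiple 1≤n nx≈ε h | multiple 1≤n nx≈ε k
  ... | a , y≈ | b , z≈ = a + b , G.trans (G.∙-cong y≈ z≈) (G.sym (×-homo-+ x a b))
  multiple {suc n} {x} 1≤n nx≈ε (inv {y} h) with multiple 1≤n nx≈ε h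
  ... | a , y≈ = n * a , G.sym (GroupProperties.inverseʳ-unique G.group y ((n * a) · x) (begin
    y ∙ (n * a) · x              ≈⟨ G.∙-congʳ y≈ ⟩
    a · x ∙ (n * a) · x          ≈⟨ ×-homo-+ x a (n * a) ⟨
    (suc n * a) · x              ≈⟨ ·-congˡ x (*-comm (suc n) a) ⟩
    (a * suc n) · x              ≈⟨ ×-assocˡ x a (suc n) ⟨
    a · (suc n · x)              ≈⟨ G.trans (×-congʳ a nx≈ε) (·-zero a) ⟩
    ε                            ∎))
  multiple 1≤n nx≈ε (resp y≈z h) with multiple 1≤n nx≈ε h
  ... | a , y≈ = a , G.trans (G.sym y≈z) y≈

  -- If n g₀ vanishes, exponents matter only modulo n, and G injects into `Fin n`.
  order-≥ : ∀ {n} → 1 ≤ n → n · g₀ ≈ ε → p ≤ n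
  order-≥ {n@(suc _)} 1≤n ng≈ε = Fin.injective⇒≤ {f = index} injective
    where
    exponent : ∀ i → ∃ λ k → Card.to i ≈ k · g₀
    exponent i = multiple 1≤n ng≈ε (proj₂ cyclic (Card.to i))
    index : Fin p → Fin n
    index i = Fin.fromℕ< (m%n<n (proj₁ (exponent i)) n)
    recover : ∀ i → Card.to i ≈ Fin.toℕ (index i) · g₀
    recover i = G.trans (proj₂ (exponent i)) (G.trans (·-% ng≈ε (proj₁ (exponent i)))
      (·-congˡ g₀ (sym (Fin.toℕ-fromℕ< (m%n<n (proj₁ (exponent i)) n)))))
    injective : ∀ {i j} → index i ≡ index j → i ≡ j
    injective {i} {j} eq = sym (Card.strictlyInverseʳ i) ⨟ Card.from-cong (begin
      Card.to i                  ≈⟨ recover i ⟩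
      Fin.toℕ (index i) · g₀     ≈⟨ ·-congˡ g₀ (cong Fin.toℕ eq) ⟩
      Fin.toℕ (index j) · g₀     ≈⟨ recover j ⟨
      Card.to j                  ∎) ⨟ Card.strictlyInverseʳ j

  p·g₀ : p · g₀ ≈ ε
  p·g₀ = let (n , 1≤n , n≤p , ng≈ε) = finite-order g₀ in G.trans (·-congˡ g₀ (≤-antisym (order-≥ 1≤n ng≈ε) n≤p)) ng≈ε

  ∼⇒≈ : ∀ {m n} → m ∼ n → m · g₀ ≈ n · g₀
  ∼⇒≈ {m} {n} h = G.trans (·-% p·g₀ m) (G.trans (·-congˡ g₀ h) (G.sym (·-% p·g₀ n)))

  ≈ε⇒∼0 : ∀ {m} → m · g₀ ≈ ε → m ∼ 0
  ≈ε⇒∼0 {m} h with 1 ≤? m % p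
  ... | no ¬1≤ = n<1⇒n≡0 (≰⇒> ¬1≤) ⨟ sym 0%p
  ... | yes 1≤ = contradiction (order-≥ 1≤ (G.trans (G.sym (·-% p·g₀ m)) h)) (<⇒≱ (m%n<n m p))

  ≈⇒∼ : ∀ {m n} → m · g₀ ≈ n · g₀ → m ∼ n
  ≈⇒∼ {m} {n} h = ∼-cancelʳ (neg n) (≈ε⇒∼0 (begin
    (m + neg n) · g₀            ≈⟨ ×-homo-+ g₀ m (neg n) ⟩
    m · g₀ ∙ neg n · g₀         ≈⟨ G.∙-congʳ h ⟩
    n · g₀ ∙ neg n · g₀         ≈⟨ ×-homo-+ g₀ n (neg n) ⟨
    (n + neg n) · g₀            ≈⟨ ∼⇒≈ (+-neg n) ⟩
    ε                           ∎) ▸ sym (+-neg n))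

  abstract
    log-full : ∀ x → ∃ λ k → x ≈ k · g₀
    log-full x = multiple (>-nonZero⁻¹ p) p·g₀ (proj₂ cyclic x)

    log : Carrier → ℕ
    log x = proj₁ (log-full x) % p

    log<p : ∀ x → log x < p
    log<p x = m%n<n (proj₁ (log-full x)) p

    log-correct : ∀ x → x ≈ log x · g₀
    log-correct x = G.trans (proj₂ (log-full x)) (·-% p·g₀ (proj₁ (log-full x)))

  log≁0 : ∀ {x} → ¬ x ≈ ε → ¬ log x ∼ 0
  log≁0 {x} x≉ε h = x≉ε (G.trans (log-correct x) (∼⇒≈ h))

  ·-log : ∀ m x → m · x ≈ (m * log x) · g₀
  ·-log m x = G.trans (×-congʳ m (log-correct x)) (×-assocˡ g₀ m (log x))

  -- p is prime, so the logarithm of a nonidentity element is invertible modulo p.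
  generates : ∀ {x} → ¬ x ≈ ε → ∀ y → ∃ λ k → y ≈ k · x
  generates {x} x≉ε y = from (inverse (log≁0 x≉ε))
    where
    from : (∃ λ d → d * log x ∼ 1) → ∃ λ k → y ≈ k · x
    from (d , dx∼1) = log y * d , (begin
      y                              ≈⟨ log-correct y ⟩
      log y · g₀                     ≈⟨ ∼⇒≈ (sym (≡⇒∼ (*-assoc (log y) d (log x)) ▸ ∼-*ˡ (log y) dx∼1
                                                ▸ ≡⇒∼ (*-identityʳ (log y)))) ⟩
      (log y * d * log x) · g₀       ≈⟨ ·-log (log y * d) x ⟨
      (log y * d) · x                ∎)

  multiples-in : ∀ {s} {S : Carrier → Set s} {x} → ⟨_⟩ G S x → ∀ k → ⟨_⟩ G S (k · x)
  multiples-in h zero    = unit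
  multiples-in h (suc k) = mul h (multiples-in h k)

  everything : ∀ {s} {S : Carrier → Set s} {x} → ¬ x ≈ ε → ⟨_⟩ G S x → ∀ y → ⟨_⟩ G S y
  everything x≉ε h y = let (k , y≈) = generates x≉ε y in resp (G.sym y≈) (multiples-in h k)

  has-order-p : ∀ {x} → ¬ x ≈ ε → HasOrder G x p
  has-order-p {x} x≉ε = record
    { annihilates = G.trans (·-log p x) (∼⇒≈ (≡⇒∼ (*-comm p (log x)) ▸ n*p∼0 (log x)))
    ; least = λ m 1≤m m<p mx≈ε → ≁0 1≤m m<p
        (∼-cancel-* (log≁0 x≉ε) (≈ε⇒∼0 (G.trans (G.sym (·-log m x)) mx≈ε)))
    }

  order-unique : ∀ {x n} → ¬ x ≈ ε → HasOrder G x n → n ≡ p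
  order-unique {x} {n} x≉ε ord = ≤-antisym
    (≮⇒≥ λ p<n → HasOrder.least ord p (>-nonZero⁻¹ p) p<n (HasOrder.annihilates (has-order-p x≉ε)))
    (≮⇒≥ λ n<p → HasOrder.least (has-order-p x≉ε) n (>-nonZero⁻¹ n {{HasOrder.nonZero ord}}) n<p (HasOrder.annihilates ord))

  module _ (T : Sequence G) (mzs : IsMinimalZeroSum G T) (long : p ≤ 1 + 2 * length T) where

    open IsMinimalZeroSum mzs

    ↭⇒↭ₛ : ∀ {L M : List Carrier} → L ↭ M → SetoidPermutation._↭_ G.setoid L M
    ↭⇒↭ₛ refl            = SetoidPermutation.↭-refl G.setoid
    ↭⇒↭ₛ (prep x h)      = SetoidPermutation.prep G.refl (↭⇒↭ₛ h)
    ↭⇒↭ₛ (swap x y h)    = SetoidPermutation.swap G.refl G.refl (↭⇒↭ₛ h)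
    ↭⇒↭ₛ (trans h k)     = SetoidPermutation.trans (↭⇒↭ₛ h) (↭⇒↭ₛ k)

    no-zero-sum : ∀ {u U r R} → u ∷ U ++ r ∷ R ↭ T → ¬ σ G (u ∷ U) ≈ ε
    no-zero-sum {u} {U} {r} {R} perm = minimal (u ∷ U) (r ∷ R , ↭⇒↭ₛ perm) (s≤s z≤n)
      (≤-trans (s≤s (≤-trans (m≤m+n (suc (length U)) (length R))
        (≡⇒≤ (sym (+-suc (length U) (length R)) ⨟ sym (length-++ U))))) (≡⇒≤ (↭.↭-length perm)))

    nonzero-terms : All (λ t → ¬ t ≈ ε) T
    nonzero-terms = All.tabulate nonzero
      where
      nonzero : ∀ {t} → t ∈ T → ¬ t ≈ ε
      nonzero {t} t∈T t≈ε with ∈-∃++ t∈T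
      ... | A , B , eq = rest (A ++ B) (↭-sym (subst (_↭ t ∷ A ++ B) (sym eq) (↭.shift t A B)))
        where
        rest : ∀ L → t ∷ L ↭ T → ⊥
        rest []      perm = contradiction
          (≤-trans 157≤p (subst (λ l → p ≤ 1 + 2 * l) (sym (↭.↭-length perm)) long)) (<⇒≱ (m≤m+n 4 153))
        rest (r ∷ L) perm = no-zero-sum {t} {[]} perm (G.trans (G.identityʳ t) t≈ε)

    logs : List ℕ
    logs = map log T

    σ-log : ∀ L → σ G L ≈ sum (map log L) · g₀
    σ-log []      = G.refl
    σ-log (x ∷ L) = G.trans (G.∙-cong (log-correct x) (σ-log L)) (G.sym (×-homo-+ g₀ (log x) _))

    logs-mzs : MinimalZeroSum logs
    logs-mzs = record
      { range   = All.map⁺ (All.map (λ {t} t≉ε → n≢0⇒n>0 (λ z → log≁0 t≉ε (≡⇒∼ z)) , log<p t) nonzero-terms)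
      ; total   = ≈ε⇒∼0 (G.trans (G.sym (σ-log T)) zeroSum)
      ; minimal = minimal'
      ; long    = subst (λ l → p ≤ 1 + 2 * l) (sym (length-map log T)) long
      }
      where
      minimal' : ∀ {u U r R} → u ∷ U ++ r ∷ R ↭ logs → ¬ sum (u ∷ U) ∼ 0
      minimal' {u} {U} {r} {R} perm z with ↭.↭-map-inv log (↭-sym perm)
      ... | L , eq , T↭L with map-split log (u ∷ U) L eq
      ...   | m ∷ M , n ∷ N , refl , refl , _ =
        no-zero-sum {m} {M} {n} {N} (↭-sym T↭L) (G.trans (σ-log (m ∷ M)) (∼⇒≈ z))

    -- Comparing logarithms in t ≈ y g and multiplying by d, the inverse of `log g`, recovers y
    -- modulo p. The value y = p is excluded because t is not the identity.
    coefficients-unique : ∀ {g} d {L ys} → d * log g ∼ 1 → All (λ t → ¬ t ≈ ε) L →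
      Pointwise (λ y t → (1 ≤ y × y ≤ p) × t ≈ y · g) ys L → ys ≡ rescale d (map log L)
    coefficients-unique d dg∼1 [] [] = refl
    coefficients-unique {g} d {t ∷ L} {y ∷ ys} dg∼1 (t≉ε ∷ L≉ε) (((1≤y , y≤p) , t≈yg) ∷ rest) =
      cong₂ _∷_ (sym (m<n⇒m%n≡m y<p) ⨟ y∼) (coefficients-unique {g} d dg∼1 L≉ε rest)
      where
      y<p : y < p
      y<p = ≤∧≢⇒< y≤p λ { refl → t≉ε (G.trans t≈yg (G.trans (·-log p g) (∼⇒≈ (≡⇒∼ (*-comm p (log g)) ▸ n*p∼0 (log g))))) }
      y∼ : y ∼ d * log t
      y∼ = sym (≡⇒∼ (arith d y (log g)) ▸ ∼-*ˡ y dg∼1 ▸ ≡⇒∼ (*-identityʳ y))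
           ▸ ∼-*ˡ d (≈⇒∼ (G.trans (G.sym (·-log y g)) (G.trans (G.sym t≈yg) (log-correct t))))
        where
        arith : ∀ d y k → d * (y * k) ≡ y * (d * k)
        arith = solve-∀

    represents : ∀ {g c L} → ¬ c ∼ 0 → c * log g ∼ 1 → All (λ t → ¬ t ≈ ε) L →
      Pointwise (λ y t → (1 ≤ y × y ≤ p) × t ≈ y · g) (rescale c (map log L)) L
    represents c≁0 cg∼1 [] = []
    represents {g} {c} {t ∷ L} c≁0 cg∼1 (t≉ε ∷ L≉ε) =
      ((n≢0⇒n>0 (λ z → *≁0 c≁0 (log≁0 t≉ε) (z ⨟ sym 0%p)) , <⇒≤ (m%n<n _ p)) , G.sym (begin
        (c * log t % p) · g                ≈⟨ ·-log (c * log t % p) g ⟩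
        (c * log t % p * log g) · g₀       ≈⟨ ∼⇒≈ (∼-* (%-∼ (c * log t)) refl ▸ ≡⇒∼ (arith c (log t) (log g))
                                                 ▸ ∼-*ˡ (log t) cg∼1 ▸ ≡⇒∼ (*-identityʳ (log t))) ⟩
        log t · g₀                         ≈⟨ log-correct t ⟨
        t                                  ∎)) ∷ represents c≁0 cg∼1 L≉ε
      where
      arith : ∀ c t g → c * t * g ≡ t * (c * g)
      arith = solve-∀

    supp-generates : ∀ y → ⟨_⟩ G (supp G T) y
    supp-generates = from (term T long)
      where
      term : ∀ L → p ≤ 1 + 2 * length L → ∃ λ t → t ∈ L
      term []      h = contradiction (≤-trans 157≤p h) (<⇒≱ (m≤m+n 2 155))
      term (t ∷ L) _ = t , here refl
      from : (∃ λ t → t ∈ T) → ∀ y → ⟨_⟩ G (supp G T) y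
      from (t , t∈T) = everything (All.lookup nonzero-terms t∈T) (gen (Any.map G.reflexive t∈T))

    F : ℕ → ℕ
    F c = scaled c logs

    1≁0 : ¬ 1 ∼ 0
    1≁0 = ≁0 ≤-refl (<-trans (s≤s (s≤s z≤n)) 2<p)

    -- The norm with respect to h is `F e` / p for e the inverse of `log h` modulo p, so minimality
    -- over the factors covers every generator.
    minimal-norm : ∀ {c h r} → 1 ≤ c → c < p → (∀ d → 1 ≤ d → d < p → F c ≤ F d) → HasNorm G h T r →
      (+ F c) ℚ./ p ℚ.≤ r
    minimal-norm {c} {h} {r} 1≤c c<p least norm-h = from (inverse (log≁0 nonzero))
      where
      open HasNorm norm-h
      n≡p : n ≡ p
      n≡p = order-unique nonzero order
      from : (∃ λ e → e * log h ∼ 1) → (+ F c) ℚ./ p ℚ.≤ r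
      from (e , eh∼1) = subst ((+ F c) ℚ./ p ℚ.≤_) (sym norm)
        (fraction-≤ (F c) p (sum coefficients) n {{p≢0}} {{HasOrder.nonZero order}}
          (subst (λ n → F c * n ≤ sum coefficients * p) (sym n≡p) (*-monoˡ-≤ p
            (≤-trans (least (e % p) 1≤e (m%n<n e p)) (≡⇒≥ (cong sum e-coefficients))))))
        where
        e%h∼1 : e % p * log h ∼ 1
        e%h∼1 = ∼-* (%-∼ e) refl ▸ eh∼1
        1≤e : 1 ≤ e % p
        1≤e = n≢0⇒n>0 λ z → 1≁0 (sym e%h∼1 ▸ ≡⇒∼ (cong (_* log h) z))
        e-coefficients : coefficients ≡ rescale (e % p) logs
        e-coefficients = coefficients-unique (e % p) e%h∼1 nonzero-terms
          (subst (λ n → Pointwise (λ y t → (1 ≤ y × y ≤ n) × t ≈ y · h) coefficients T) n≡p (HasNorm.represents norm-h))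

    index-from-min : ∀ c → 1 ≤ c → c < p → (∀ d → 1 ≤ d → d < p → F c ≤ F d) → HasIndex G T ((+ F c) ℚ./ p)
    index-from-min c 1≤c c<p least = from (inverse (≁0 1≤c c<p))
      where
      from : (∃ λ d → d * c ∼ 1) → HasIndex G T ((+ F c) ℚ./ p)
      from (d , dc∼1) = record
        { attained   = g , ((λ _ → everything g≉ε (gen G.refl) _) , (λ _ → supp-generates _)) , norm-g
        ; lowerBound = λ h r _ → minimal-norm 1≤c c<p least
        }
        where
        -- The factor c belongs to the generator c⁻¹ g₀.
        g : Carrier
        g = d · g₀
        cg∼1 : c * log g ∼ 1
        cg∼1 = ∼-*ˡ c (≈⇒∼ (G.sym (log-correct g))) ▸ ≡⇒∼ (*-comm c d) ▸ dc∼1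
        g≉ε : ¬ g ≈ ε
        g≉ε h = 1≁0 (sym dc∼1 ▸ ∼-* (≈ε⇒∼0 {d} h) refl)
        norm-g : HasNorm G g T ((+ F c) ℚ./ p)
        norm-g = record
          { nonzero      = g≉ε
          ; n            = p
          ; order        = has-order-p g≉ε
          ; coefficients = rescale c logs
          ; represents   = represents (≁0 1≤c c<p) cg∼1 nonzero-terms
          ; norm         = refl
          }

    index≤2 : ∃[ q ] HasIndex G T q × q ℚ.≤ (+ 2 ℚ./ 1)
    index≤2 = from (m≤n⇒∃[o]m+o≡n (<⇒≤ 2<p)) (done logs-mzs)
      where
      from : (∃ λ n → 2 + n ≡ p) → Done logs → ∃[ q ] HasIndex G T q × q ℚ.≤ (+ 2 ℚ./ 1)
      from (n , 2+n≡p) (c₀ , 1≤c₀ , c₀<p , Fc₀≤2p) =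
        -- With p = n + 2 the search covers all factors from 1 to p - 1.
        let (c , 1≤c , c≤ , least) = argmin F n
            least-p : ∀ d → 1 ≤ d → d < p → F c ≤ F d
            least-p d 1≤d d<p = least d 1≤d (≤-pred (≤-trans d<p (≡⇒≥ 2+n≡p)))
        in (+ F c) ℚ./ p , index-from-min c 1≤c (≤-trans (s≤s c≤) (≡⇒≤ 2+n≡p)) least-p ,
           fraction-≤ (F c) p 2 1 (≤-trans (≡⇒≤ (*-identityʳ (F c))) (≤-trans (least-p c₀ 1≤c₀ c₀<p) Fc₀≤2p))

theorem1p5 : ∀ {c ℓ} (G : AbelianGroup c ℓ) (p : ℕ) →
    Prime p → p > 155 → IsCyclic G → HasCardinality G p →
    (T : Sequence G) → IsMinimalZeroSum G T → p ∸ 1 ≤ 2 * length T →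
    ∃[ q ] HasIndex G T q × q ℚ.≤ (+ 2 ℚ./ 1)
theorem1p5 G p p-prime 155<p cyclic cardinality T mzs long =
  Cyclic.index≤2 G p {{prime⇒nonZero p-prime}} p-prime (prime>155⇒≥157 p-prime 155<p) cyclic cardinality T mzs
    (≤-trans (m≤n+m∸n p 1) (s≤s long))
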